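{- For every integer $t\ge 0$, there exists an integer $n\ge 1$ such that for any partition $A_1,A_2$ of the vertex set of $Q_n$, at least one of the induced subgraphs $Q_n[A_1]$, $Q_n[A_2]$ has tree-width at least $t$.
   Context: For an integer $n\ge 1$, $Q_n$ is the simple undirected graph with vertex set $\{(x,y,z)\in\mathbb{Z}^3: 0\le x,y,z\le n-1\}$ in which two distinct vertices are adjacent if they can be named $(x,y,z)$ and $(x',y',z')$ in such a way that $x\le x'\le x+1$, $y\le y'\le y+1$ and $z\le z'\le z+1$ (the $n\times n\times n$ grid with all non-decreasing diagonals in its unit cubes). Tree-width has its standard meaning: the width of a tree decomposition is the maximum size of its bags minus one, and the tree-width of a graph is the minimum width of its tree decompositions. -}

module Defs where

open import Data.Bool using (Bool; T)
open import Data.Fin using (Fin; toℕ)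
open import Data.Integer as ℤ using (ℤ; +_; _⊖_)
import Data.Integer.Properties as ℤₚ
open import Data.List using (List; []; _∷_; _++_; [_]; length; tabulate)
open import Data.List.Extrema.Nat using (max)
open import Data.List.Membership.Propositional using (_∈_)
open import Data.List.Relation.Unary.Linked using (Linked)
open import Data.List.Relation.Unary.Unique.Propositional using (Unique)
open import Data.Nat using (ℕ; suc; _≤_)
open import Data.Product using (Σ; ∃; _×_; _,_; proj₁)
open import Data.Sum using (_⊎_; swap)
open import Function using (_∘_; _⇔_; mk⇔)
open import Level using (0ℓ)
open import Relation.Binary using (Rel; Symmetric)
open import Relation.Binary.Construct.Closure.ReflexiveTransitive using (Star)
open import Relation.Binary.PropositionalEquality using (_≡_; _≢_; refl; sym)
open import Relation.Nullary using (¬_)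
open import Relation.Unary using (Pred; U)

record Graph (V : Set) : Set₁ where
  field
    Adj    : Rel V 0ℓ
    symm   : Symmetric Adj
    irrefl : ∀ {v} → ¬ Adj v v

-- Vertex sets are Bool-valued so that membership proofs are unique and
-- Σ V (T ∘ A) contains each vertex of A exactly once.
induced : {V : Set} → Graph V → (A : V → Bool) → Graph (Σ V (T ∘ A))
induced G A = record
  { Adj    = λ u v → Graph.Adj G (proj₁ u) (proj₁ v)
  ; symm   = Graph.symm G
  ; irrefl = Graph.irrefl G
  }

-- Parts may be empty.
record IsPartition {V : Set} (A₁ A₂ : V → Bool) : Set where
  field
    cover    : ∀ v → T (A₁ v) ⊎ T (A₂ v)
    disjoint : ∀ v → ¬ (T (A₁ v) × T (A₂ v))

module _ {V : Set} (G : Graph V) where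
  open Graph G

  -- Any two vertices of S are joined by a walk that stays inside S.
  ConnectedOn : Pred V 0ℓ → Set
  ConnectedOn S = ∀ {u v} → S u → S v → Star (λ a b → Adj a b × S a × S b) u v

  -- A cycle x , xs , x has pairwise distinct vertices x ∷ xs, at least three
  -- in number.
  Acyclic : Set
  Acyclic = ∀ x xs → 2 ≤ length xs → Unique (x ∷ xs) →
            ¬ Linked Adj (x ∷ xs ++ [ x ])

  record IsTree : Set where
    field
      nonempty  : V
      connected : ConnectedOn U
      acyclic   : Acyclic

record TreeDecomposition {V : Set} (G : Graph V) : Set₁ where
  field
    nodes      : ℕ
    tree       : Graph (Fin nodes)
    isTree     : IsTree tree
    bag        : Fin nodes → List V
    bag-unique : ∀ i → Unique (bag i)
    vertices   : ∀ v → ∃ λ i → v ∈ bag i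
    edges      : ∀ {u v} → Graph.Adj G u v → ∃ λ i → u ∈ bag i × v ∈ bag i
    subtrees   : ∀ v → ConnectedOn tree (λ i → v ∈ bag i)

  -- An integer, since the graph without vertices has a decomposition of
  -- width -1.
  width : ℤ
  width = max 0 (tabulate (length ∘ bag)) ⊖ 1

open TreeDecomposition using (width)

IsTreewidth : {V : Set} → Graph V → ℤ → Set₁
IsTreewidth G w = (∃ λ (D : TreeDecomposition G) → width D ≡ w) ×
                  (∀ (D : TreeDecomposition G) → w ℤ.≤ width D)

TreewidthAtLeast : {V : Set} → Graph V → ℕ → Set₁
TreewidthAtLeast G t = ∀ (D : TreeDecomposition G) → + t ℤ.≤ width D

treewidthAtLeast⇔ : {V : Set} {G : Graph V} {w : ℤ} {t : ℕ} →
                    IsTreewidth G w → TreewidthAtLeast G t ⇔ (+ t ℤ.≤ w)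
treewidthAtLeast⇔ ((D , refl) , minimal) =
  mk⇔ (λ t≤ → t≤ D) (λ t≤w D′ → ℤₚ.≤-trans t≤w (minimal D′))

Vertex : ℕ → Set
Vertex n = Fin n × Fin n × Fin n

infix 4 _≲_ _⊑_

_≲_ : {n : ℕ} → Rel (Fin n) 0ℓ
i ≲ j = toℕ i ≤ toℕ j × toℕ j ≤ suc (toℕ i)

_⊑_ : {n : ℕ} → Rel (Vertex n) 0ℓ
(x , y , z) ⊑ (x′ , y′ , z′) = x ≲ x′ × y ≲ y′ × z ≲ z′

Q : (n : ℕ) → Graph (Vertex n)
Q n = record
  { Adj    = λ u v → u ≢ v × (u ⊑ v ⊎ v ⊑ u)
  ; symm   = λ (u≢v , uv) → u≢v ∘ sym , swap uv
  ; irrefl = λ (v≢v , _) → v≢v refl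
  }

{-# OPTIONS --safe #-}

-- Suppose that Q[A₁] and Q[A₂] have tree decompositions with bags of at most t
-- vertices.  Since Q[A₁] has bounded degree and bounded treewidth, A₁ splits
-- into sets B and X whose components have bounded diameter (the theorem of Ding
-- and Oporowski; bounded diameter is all that is needed).  Triangulate the cube
-- and choose 0/1-valued functions a, b, c on its vertices which are the
-- indicators of three half-spaces, one for each axis, except that a is made
-- constant on the components of B, and b and c on those of X.  Modulo 2, the
-- cochain δa ∪ δb ∪ δc with the vertices of B ordered first has sum 1 over all
-- tetrahedra, by Stokes.  It vanishes on every tetrahedron inside B ∪ X, and also
-- on those inside B ∪ X ∪ Y if Y ⊆ A₂ is far from the planes at which b and c
-- jump; a set Y of bounded size can always be avoided.
--
-- For H ⊆ A₂ whose neighbours in A₂ lie in H ∪ Y, let the degree of H be the sum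
-- over the tetrahedra that meet H, for planes that avoid Y.  Stokes shows that it
-- does not depend on these planes.  Removing the leaves of a tree decomposition
-- of Q[A₂] one by one shows that each set which is cut off by a bag has degree 0:
-- passing from the bag of a leaf to that of its neighbour, only tetrahedra inside
-- B ∪ X and the two bags are added, and planes can be chosen to avoid both bags.
-- At the last node every tetrahedron has been counted or is inside B ∪ X ∪ Y, so
-- 1 = 0.
--
-- The existence of B and X is a finite search, which decides constructively which
-- of the two parts has large treewidth.

module Submission where

open import Defs
open import Data.Bool using (Bool; T; true; false; _∧_; _∨_; not; _xor_; if_then_else_)
open import Data.Bool.ListAction using (any)
open import Data.Bool.Solver using (module xor-∧-Solver)
import Data.Bool.Properties as Bool
open import Data.Fin using (Fin; zero; suc; toℕ; fromℕ<)
import Data.Fin.Properties as Fin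
open import Data.Empty using (⊥; ⊥-elim)
open import Data.List using (List; []; _∷_; _++_; [_]; length; filter; allFin; lookup; cartesianProduct)
open import Data.List.Membership.Propositional using (_∈_; find; lose)
open import Data.List.Membership.Propositional.Properties using (∈-filter⁺; ∈-filter⁻; ∈-allFin; ∈-map⁺; ∈-map⁻; ∈-++⁺ˡ; ∈-++⁺ʳ; ∈-cartesianProduct⁺; ∈-lookup)
open import Data.List.Extrema.Nat using (max; xs≤max)
import Data.List as List
import Data.List.Properties as List
open import Data.List.Relation.Unary.All as All using (All; []; _∷_; all?)
open import Data.List.Relation.Unary.All.Properties using (¬All⇒Any¬; tabulate⁻)
open import Data.List.Relation.Unary.Any as Any using (here; there; any?)
open import Data.List.Relation.Unary.Any.Properties using (lookup-index)
open import Data.List.Relation.Unary.AllPairs using ([]; _∷_)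
open import Data.List.Relation.Unary.Linked using (Linked; []; [-]; _∷_)
open import Data.List.Relation.Unary.Unique.Propositional using (Unique)
open import Data.List.Relation.Unary.Unique.Propositional.Properties using (allFin⁺; cartesianProduct⁺)
open import Data.Nat using (ℕ; zero; suc; _+_; _∸_; _*_; _≤_; _<_; _≥_; z≤n; s≤s)
import Data.Nat.Properties as ℕ
import Data.Product as ×
import Data.Product.Properties as ×
open import Data.Product using (Σ; ∃; _×_; _,_; proj₁; proj₂)
open import Data.Integer as ℤ using (_⊖_; +≤+)
import Data.Integer.Properties as ℤ
open import Data.Vec as Vec using (Vec; []; _∷_)
import Data.Vec.Properties as Vec
open import Data.Unit using (⊤; tt)
import Data.Sum as ⊎
open import Data.Sum using (_⊎_; inj₁; inj₂; [_,_]′; swap)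
open import Function using (Equivalence; _∘_; case_of_)
open import Relation.Binary.Construct.Closure.ReflexiveTransitive as Star using (Star; ε; _◅_)
open import Relation.Binary.PropositionalEquality using (_≡_; _≢_; refl; sym; trans; cong; cong₂; subst; module ≡-Reasoning)
open import Relation.Nullary.Decidable using (dec-true; dec-false; ¬¬-excluded-middle; decidable-stable; map′)
open import Relation.Nullary using (¬_; Dec; does; yes; no; contradiction; ¬?; _×-dec_; _⊎-dec_; _→-dec_)

open xor-∧-Solver using (solve; _:=_; _:+_; _:*_; con)

-- Sets given by Boolean indicators

infix 4 _∈ᵇ_
_∈ᵇ_ : {V : Set} → V → (V → Bool) → Set
v ∈ᵇ P = P v ≡ true

∨-inv : ∀ {x y} → x ∨ y ≡ true → x ≡ true ⊎ y ≡ true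
∨-inv {true}  _ = inj₁ refl
∨-inv {false} e = inj₂ e

∨-inl : ∀ {x y} → x ≡ true → x ∨ y ≡ true
∨-inl refl = refl

∨-inr : ∀ {x y} → y ≡ true → x ∨ y ≡ true
∨-inr {true}  _ = refl
∨-inr {false} e = e

∧-inv : ∀ {x y} → x ∧ y ≡ true → x ≡ true × y ≡ true
∧-inv {true} e = refl , e

∧-intro : ∀ {x y} → x ≡ true → y ≡ true → x ∧ y ≡ true
∧-intro refl refl = refl

true≢false : ∀ {x} {W : Set} → x ≡ true → x ≡ false → W
true≢false refl ()

not-true : ∀ {x} → not x ≡ true → x ≡ false
not-true {false} _ = refl

decide : ∀ x → x ≡ true ⊎ x ≡ false
decide true  = inj₁ refl
decide false = inj₂ refl

-- Elimination of the leaves of a tree decomposition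

Unique⇒lookup-injective : {X : Set} {xs : List X} → Unique xs → ∀ i j → lookup xs i ≡ lookup xs j → i ≡ j
Unique⇒lookup-injective (x∉ ∷ u) zero    zero    e = refl
Unique⇒lookup-injective (x∉ ∷ u) zero    (suc j) e = contradiction e (All.lookup x∉ (∈-lookup j))
Unique⇒lookup-injective (x∉ ∷ u) (suc i) zero    e = contradiction (sym e) (All.lookup x∉ (∈-lookup i))
Unique⇒lookup-injective (x∉ ∷ u) (suc i) (suc j) e = cong suc (Unique⇒lookup-injective u i j e)

module _ {m : ℕ} (G : Graph (Fin m)) (adj? : ∀ i j → Dec (Graph.Adj G i j)) (acyclic : Acyclic G) where
  open Graph G

  -- For connected `L` the first alternative means that a single node is left, which ends the
  -- elimination.
  HasLeaf : List (Fin m) → Set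
  HasLeaf L = ∃ λ ℓ → ℓ ∈ L ×
    ((∀ {y} → y ∈ L → ¬ Adj ℓ y) ⊎
     (∃ λ p → p ∈ L × Adj ℓ p × (∀ {y} → y ∈ L → Adj ℓ y → y ≡ p)))

  private
    -- Cuts the path after `y` and appends `e`. In `grow`, `e` is the vertex before `z`, so the
    -- result closes up to a cycle.
    close-path : ∀ {z y e} zs → y ∈ zs → Linked Adj (z ∷ zs) → Unique zs → Adj y e →
                 ∃ λ ws → Linked Adj (z ∷ ws ++ [ e ]) × Unique ws × (∀ {w} → w ∈ ws → w ∈ zs) × 1 ≤ length ws
    close-path (y ∷ zs) (here refl) (a ∷ _) _ ye =
      [ y ] , a ∷ ye ∷ [-] , [] ∷ [] , (λ { (here q) → here q }) , s≤s z≤n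
    close-path (z′ ∷ zs) (there y∈) (a ∷ l) (z′∉ ∷ u) ye with close-path zs y∈ l u ye
    ... | ws , l′ , u′ , ⊆ , _ =
      z′ ∷ ws , a ∷ l′ , All.tabulate (λ w∈ → All.lookup z′∉ (⊆ w∈)) ∷ u′ ,
      (λ { (here q) → here q ; (there w∈) → there (⊆ w∈) }) , s≤s z≤n

    unique-length : ∀ (xs : List (Fin m)) → Unique xs → length xs ≤ m
    unique-length xs u = Fin.injective⇒≤ (λ {i} {j} → Unique⇒lookup-injective u i j)

    -- A path in `L` is extended at its head for as long as possible. A head that cannot be extended
    -- is a leaf, since a second neighbour on the path would close a cycle. Paths have at most `m`
    -- vertices, and `k` bounds the extensions that remain.
    grow : ∀ L k x xs → Unique (x ∷ xs) → Linked Adj (x ∷ xs) → All (_∈ L) (x ∷ xs) →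
           m < k + length (x ∷ xs) → HasLeaf L
    grow L zero x xs u l all< m<  = contradiction (unique-length _ u) (ℕ.<⇒≱ m<)
    grow L (suc k) x [] u l (x∈ ∷ []) m< with any? (adj? x) L
    ... | no ¬a = x , x∈ , inj₁ (λ y∈ a → ¬a (lose y∈ a))
    ... | yes a with find a
    ... | y , y∈ , xy =
      grow L k y [ x ] (((λ { refl → irrefl xy }) ∷ []) ∷ u) (symm xy ∷ l) (y∈ ∷ x∈ ∷ [])
        (subst (m <_) (sym (ℕ.+-suc k 1)) m<)
    grow L (suc k) x (p ∷ xs) u@((x≢p ∷ x∉) ∷ up@(p∉ ∷ uxs)) l@(xp ∷ lp) all∈@(x∈ ∷ p∈ ∷ _) m<
      with any? (λ y → adj? x y ×-dec ¬? (y Fin.≟ p)) L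
    ... | no ¬a = x , x∈ , inj₂ (p , p∈ , xp , only)
      where
      only : ∀ {y} → y ∈ L → Adj x y → y ≡ p
      only {y} y∈ a with y Fin.≟ p
      ... | yes e = e
      ... | no ne = contradiction (lose y∈ (a , ne)) ¬a
    ... | yes a with find a
    ... | y , y∈ , xy , y≢p with any? (y Fin.≟_) xs
    ... | no y∉ =
      grow L k y (x ∷ p ∷ xs)
        (((λ { refl → irrefl xy }) ∷ y≢p ∷ All.tabulate (λ z∈ e → y∉ (lose z∈ e))) ∷ u)
        (symm xy ∷ l) (y∈ ∷ all∈) (subst (m <_) (sym (ℕ.+-suc k _)) m<)
    ... | yes y∈xs with close-path xs y∈xs lp uxs (symm xy)
    ... | ws , l′ , u′ , ⊆ , 1≤ =
      contradiction (xp ∷ l′)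
        (acyclic x (p ∷ ws) (s≤s 1≤)
          ((x≢p ∷ All.tabulate (λ w∈ → All.lookup x∉ (⊆ w∈))) ∷
           All.tabulate (λ w∈ → All.lookup p∉ (⊆ w∈)) ∷ u′))

  has-leaf : ∀ {x L} → x ∈ L → HasLeaf L
  has-leaf {x} {L} x∈ = grow L m x [] ([] ∷ []) [-] (x∈ ∷ []) (ℕ.≤-reflexive (ℕ.+-comm 1 m))

-- S₁ is the bag that absorbs a leaf with bag S₂; H₁ and H₂ are the vertices
-- already hanging from the two nodes.
merge : {V : Set} → (H₁ H₂ S₁ S₂ : V → Bool) → V → Bool
merge H₁ H₂ S₁ S₂ v = H₁ v ∨ (H₂ v ∨ (S₂ v ∧ not (S₁ v)))

module Elimination
  {V : Set} (A : V → Bool) (Touch : V → V → Set)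
  (touch-refl : ∀ {v} → Touch v v) (touch-sym : ∀ {u v} → Touch u v → Touch v u)
  {m : ℕ} (Tr : Graph (Fin m)) (adj? : ∀ i j → Dec (Graph.Adj Tr i j)) (isTree : IsTree Tr)
  (Y : Fin m → V → Bool)
  (Y⊆A : ∀ {i v} → v ∈ᵇ Y i → v ∈ᵇ A)
  (cobag : ∀ {u v} → u ∈ᵇ A → v ∈ᵇ A → Touch u v → ∃ λ i → u ∈ᵇ Y i × v ∈ᵇ Y i)
  (conn : ∀ v → ConnectedOn Tr (λ i → v ∈ᵇ Y i))
  where

  open Graph Tr
  open IsTree isTree

  Closed : (S H : V → Bool) → Set
  Closed S H = ∀ {u v} → u ∈ᵇ H → v ∈ᵇ A → Touch u v → v ∈ᵇ H ⊎ v ∈ᵇ S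

  module _
    (Φ : Fin m → (V → Bool) → Set)
    (Φ-empty : ∀ i → Φ i (λ _ → false))
    (Φ-step : ∀ p ℓ {H₁ H₂} → Φ p H₁ → Φ ℓ H₂ →
      (∀ {v} → v ∈ᵇ H₁ → v ∈ᵇ A) → (∀ {v} → v ∈ᵇ H₂ → v ∈ᵇ A) →
      Closed (Y p) H₁ → Closed (Y ℓ) H₂ → Closed (Y p) (merge H₁ H₂ (Y p) (Y ℓ)) →
      (∀ {u v} → u ∈ᵇ H₁ → v ∈ᵇ H₂ ⊎ (v ∈ᵇ Y ℓ × Y p v ≡ false) → ¬ Touch u v) →
      Φ p (merge H₁ H₂ (Y p) (Y ℓ)))
    where

    private
      On : List (Fin m) → (Fin m → Set) → Set
      On L S = ConnectedOn Tr (λ i → i ∈ L × S i)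

      -- hang i consists of vertices whose bags have all been removed, attached to
      -- the remaining node i at which they were cut off.
      record State (L : List (Fin m)) : Set where
        field
          hang      : Fin m → V → Bool
          hang⊆A    : ∀ {i v} → v ∈ᵇ hang i → v ∈ᵇ A
          hang-gone : ∀ {i j v} → v ∈ᵇ hang i → j ∈ L → Y j v ≡ false
          hang-disj : ∀ {i j v} → v ∈ᵇ hang i → v ∈ᵇ hang j → i ≡ j
          hang-live : ∀ {i v} → v ∈ᵇ hang i → i ∈ L
          closed    : ∀ i → Closed (Y i) (hang i)
          -- When the last bag with both ends of an edge is removed, one of the ends starts to hang.
          cover     : ∀ {u v} → u ∈ᵇ A → v ∈ᵇ A → Touch u v →
                      (∃ λ i → i ∈ L × u ∈ᵇ Y i × v ∈ᵇ Y i) ⊎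
                      (∃ λ i → u ∈ᵇ hang i ⊎ v ∈ᵇ hang i)
          holds     : ∀ {i} → i ∈ L → Φ i (hang i)
          treeOn    : On L (λ _ → ⊤)
          bagOn     : ∀ v → On L (λ i → v ∈ᵇ Y i)

    Goal : Set
    Goal = ∃ λ i → ∃ λ H → Φ i H × (∀ {v} → v ∈ᵇ A → v ∈ᵇ Y i ⊎ v ∈ᵇ H)

    private
      without : Fin m → List (Fin m) → List (Fin m)
      without ℓ = filter (λ i → ¬? (i Fin.≟ ℓ))

      without-⊆ : ∀ {ℓ i} L → i ∈ without ℓ L → i ∈ L
      without-⊆ {ℓ} L i∈ = proj₁ (∈-filter⁻ (λ i → ¬? (i Fin.≟ ℓ)) {xs = L} i∈)

      without-≢ : ∀ {ℓ i} L → i ∈ without ℓ L → i ≢ ℓ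
      without-≢ {ℓ} L i∈ = proj₂ (∈-filter⁻ (λ i → ¬? (i Fin.≟ ℓ)) {xs = L} i∈)

      without-∈ : ∀ {ℓ i L} → i ∈ L → i ≢ ℓ → i ∈ without ℓ L
      without-∈ {ℓ} = ∈-filter⁺ (λ i → ¬? (i Fin.≟ ℓ))

      without-< : ∀ {ℓ L} → ℓ ∈ L → length (without ℓ L) < length L
      without-< {ℓ} {L} ℓ∈ = List.filter-notAll (λ i → ¬? (i Fin.≟ ℓ)) L (Any.map (λ { refl ¬e → ¬e refl }) ℓ∈)

      On-isolated : ∀ {L S ℓ i} → On L S → (∀ {y} → y ∈ L → ¬ Adj ℓ y) →
                    ℓ ∈ L → S ℓ → i ∈ L → S i → i ≡ ℓ
      On-isolated on ¬a ℓ∈ Sℓ i∈ Si with on (ℓ∈ , Sℓ) (i∈ , Si)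
      ... | ε = refl
      ... | (a , _ , (y∈ , _)) ◅ _ = contradiction a (¬a y∈)

      -- The walk from `ℓ` to `i` inside `S` must leave `ℓ` through `p`.
      On-leaf : ∀ {L S ℓ p i} → On L S → (∀ {y} → y ∈ L → Adj ℓ y → y ≡ p) →
                ℓ ∈ L → S ℓ → i ∈ L → S i → i ≢ ℓ → S p
      On-leaf {S = S} on only ℓ∈ Sℓ i∈ Si i≢ with on (ℓ∈ , Sℓ) (i∈ , Si)
      ... | ε = contradiction refl i≢
      ... | (a , _ , (y∈ , Sy)) ◅ _ = subst S (only y∈ a) Sy

      -- A walk can visit `ℓ` only as a detour from `p` back to `p`, and detours are cut out. In
      -- `shorten`, a walk that starts at `ℓ` is made to start at `p`, which keeps the induction
      -- going.
      On-without : ∀ {L S ℓ p} → On L S → (∀ {y} → y ∈ L → Adj ℓ y → y ≡ p) → On (without ℓ L) S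
      On-without {L} {S} {ℓ} {p} on only (u∈ , Su) (w∈ , Sw) =
        proj₁ (shorten (without-≢ L w∈) (on (without-⊆ L u∈ , Su) (without-⊆ L w∈ , Sw))) (without-≢ L u∈)
        where
        R R′ : Fin m → Fin m → Set
        R  a b = Adj a b × (a ∈ L × S a) × (b ∈ L × S b)
        R′ a b = Adj a b × (a ∈ without ℓ L × S a) × (b ∈ without ℓ L × S b)
        shorten : ∀ {x w} → w ≢ ℓ → Star R x w → (x ≢ ℓ → Star R′ x w) × (x ≡ ℓ → Star R′ p w)
        shorten w≢ ε = (λ _ → ε) , (λ e → contradiction e w≢)
        shorten {x} w≢ (_◅_ {j = y} (a , (x∈ , Sx) , (y∈ , Sy)) walk) with shorten w≢ walk | y Fin.≟ ℓ
        ... | from-y , from-ℓ | no y≢ =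
          (λ x≢ → (a , (without-∈ x∈ x≢ , Sx) , (without-∈ y∈ y≢ , Sy)) ◅ from-y y≢) ,
          (λ { refl → subst (λ z → Star R′ z _) (only y∈ a) (from-y y≢) })
        ... | from-y , from-ℓ | yes refl =
          (λ x≢ → subst (λ z → Star R′ z _) (sym (only x∈ (symm a))) (from-ℓ refl)) ,
          (λ { refl → contradiction a irrefl })

      remove : ∀ {L ℓ p} → State L → ℓ ∈ L → p ∈ L → Adj ℓ p →
               (∀ {y} → y ∈ L → Adj ℓ y → y ≡ p) → State (without ℓ L)
      remove {L} {ℓ} {p} st ℓ∈ p∈ ℓp only = record
        { hang      = hang′
        ; hang⊆A    = λ {i} → hang′⊆A i
        ; hang-gone = λ {i} → gone′ i
        ; hang-disj = λ {i} {j} → disj′ i j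
        ; hang-live = λ {i} → live′ i
        ; closed    = closed′
        ; cover     = cover′
        ; holds     = λ {i} → holds′ i
        ; treeOn    = On-without treeOn only
        ; bagOn     = λ v → On-without (bagOn v) only
        }
        where
        open State st

        p≢ℓ : p ≢ ℓ
        p≢ℓ refl = irrefl ℓp

        merged : V → Bool
        merged = merge (hang p) (hang ℓ) (Y p) (Y ℓ)

        hang′ : Fin m → V → Bool
        hang′ i with i Fin.≟ p | i Fin.≟ ℓ
        ... | yes _ | _     = merged
        ... | no _  | yes _ = λ _ → false
        ... | no _  | no _  = hang i

        Merged : V → Set
        Merged v = v ∈ᵇ hang p ⊎ v ∈ᵇ hang ℓ ⊎ (v ∈ᵇ Y ℓ × Y p v ≡ false)

        merged-inv : ∀ {v} → v ∈ᵇ merged → Merged v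
        merged-inv e with ∨-inv e
        ... | inj₁ h = inj₁ h
        ... | inj₂ e′ with ∨-inv e′
        ... | inj₁ h = inj₂ (inj₁ h)
        ... | inj₂ e″ = inj₂ (inj₂ (proj₁ (∧-inv e″) , not-true (proj₂ (∧-inv e″))))

        to-merged : ∀ {v} → Merged v → v ∈ᵇ merged
        to-merged (inj₁ h) = ∨-inl h
        to-merged {v} (inj₂ (inj₁ h)) = ∨-inr {hang p v} (∨-inl h)
        to-merged {v} (inj₂ (inj₂ (y , n))) = ∨-inr {hang p v} (∨-inr {hang ℓ v} (∧-intro y (cong not n)))

        at-p : ∀ {v} → v ∈ᵇ merged → v ∈ᵇ hang′ p
        at-p e with p Fin.≟ p
        ... | yes _ = e
        ... | no ¬r = contradiction refl ¬r

        at-other : ∀ {i v} → i ≢ p → i ≢ ℓ → v ∈ᵇ hang i → v ∈ᵇ hang′ i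
        at-other {i} i≢p i≢ℓ h with i Fin.≟ p | i Fin.≟ ℓ
        ... | yes e | _     = contradiction e i≢p
        ... | no _  | yes e = contradiction e i≢ℓ
        ... | no _  | no _  = h

        hang-any : ∀ i {v} → v ∈ᵇ hang i → ∃ λ j → v ∈ᵇ hang′ j
        hang-any i h with i Fin.≟ p
        ... | yes refl = p , at-p (to-merged (inj₁ h))
        ... | no i≢p with i Fin.≟ ℓ
        ... | yes refl = p , at-p (to-merged (inj₂ (inj₁ h)))
        ... | no i≢ℓ   = i , at-other i≢p i≢ℓ h

        merged⊆A : ∀ {v} → v ∈ᵇ merged → v ∈ᵇ A
        merged⊆A e with merged-inv e
        ... | inj₁ h = hang⊆A h
        ... | inj₂ (inj₁ h) = hang⊆A h
        ... | inj₂ (inj₂ (y , _)) = Y⊆A y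

        hang′⊆A : ∀ i {v} → v ∈ᵇ hang′ i → v ∈ᵇ A
        hang′⊆A i h with i Fin.≟ p | i Fin.≟ ℓ
        ... | yes _ | _    = merged⊆A h
        ... | no _  | no _ = hang⊆A h

        -- The bags that contain `v` form a subtree, which would pass through `p` on its way from
        -- `ℓ` to `j`.
        only-ℓ : ∀ {v j} → v ∈ᵇ Y ℓ → Y p v ≡ false → j ∈ L → j ≢ ℓ → Y j v ≡ false
        only-ℓ {v} {j} yℓ np j∈ j≢ with decide (Y j v)
        ... | inj₂ f = f
        ... | inj₁ t = true≢false (On-leaf (bagOn v) only ℓ∈ yℓ j∈ t j≢) np

        gone′ : ∀ i {j v} → v ∈ᵇ hang′ i → j ∈ without ℓ L → Y j v ≡ false
        gone′ i h j∈ with i Fin.≟ p | i Fin.≟ ℓ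
        ... | no _  | no _ = hang-gone h (without-⊆ L j∈)
        ... | yes _ | _ with merged-inv h
        ... | inj₁ h′ = hang-gone h′ (without-⊆ L j∈)
        ... | inj₂ (inj₁ h′) = hang-gone h′ (without-⊆ L j∈)
        ... | inj₂ (inj₂ (y , n)) = only-ℓ y n (without-⊆ L j∈) (without-≢ L j∈)

        merged-hang : ∀ {j v} → j ≢ p → j ≢ ℓ → v ∈ᵇ merged → v ∈ᵇ hang j → {W : Set} → W
        merged-hang j≢p j≢ℓ e h with merged-inv e
        ... | inj₁ h′ = contradiction (hang-disj h h′) j≢p
        ... | inj₂ (inj₁ h′) = contradiction (hang-disj h h′) j≢ℓ
        ... | inj₂ (inj₂ (y , _)) = true≢false y (hang-gone h ℓ∈)

        disj′ : ∀ i j {v} → v ∈ᵇ hang′ i → v ∈ᵇ hang′ j → i ≡ j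
        disj′ i j h h′ with i Fin.≟ p | i Fin.≟ ℓ | j Fin.≟ p | j Fin.≟ ℓ
        ... | yes refl | _  | yes refl | _    = refl
        ... | yes _ | _     | no n     | no k = merged-hang n k h h′
        ... | no n  | no k  | yes _    | _    = merged-hang n k h′ h
        ... | no _  | no _  | no _     | no _ = hang-disj h h′

        live′ : ∀ i {v} → v ∈ᵇ hang′ i → i ∈ without ℓ L
        live′ i h with i Fin.≟ p | i Fin.≟ ℓ
        ... | yes refl | _    = without-∈ p∈ p≢ℓ
        ... | no _     | no n = without-∈ (hang-live h) n

        stay : ∀ {v} → v ∈ᵇ Y ℓ → v ∈ᵇ merged ⊎ v ∈ᵇ Y p
        stay {v} y with decide (Y p v)
        ... | inj₁ t = inj₂ t
        ... | inj₂ f = inj₁ (to-merged (inj₂ (inj₂ (y , f))))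

        -- The new case is a vertex `u` of `Y ℓ` outside `Y p`. The only remaining bag with `u` is
        -- that of `ℓ`, so `v` shares this bag or hangs at `ℓ`.
        merged-closed : Closed (Y p) merged
        merged-closed e v∈ uv with merged-inv e
        merged-closed e v∈ uv | inj₁ h with closed p h v∈ uv
        ... | inj₁ h′ = inj₁ (to-merged (inj₁ h′))
        ... | inj₂ y  = inj₂ y
        merged-closed e v∈ uv | inj₂ (inj₁ h) with closed ℓ h v∈ uv
        ... | inj₁ h′ = inj₁ (to-merged (inj₂ (inj₁ h′)))
        ... | inj₂ y  = stay y
        merged-closed e v∈ uv | inj₂ (inj₂ (y , n)) with cover (Y⊆A y) v∈ uv
        ... | inj₂ (i , inj₁ h) = true≢false y (hang-gone h ℓ∈)
        ... | inj₂ (i , inj₂ h) with closed i h (Y⊆A y) (touch-sym uv)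
        ... | inj₁ h′ = true≢false y (hang-gone h′ ℓ∈)
        ... | inj₂ yi with i Fin.≟ ℓ
        ... | yes refl = inj₁ (to-merged (inj₂ (inj₁ h)))
        ... | no i≢ = true≢false yi (only-ℓ y n (hang-live h) i≢)
        merged-closed e v∈ uv | inj₂ (inj₂ (y , n)) | inj₁ (i , i∈ , yu , yv) with i Fin.≟ ℓ
        ... | yes refl = stay yv
        ... | no i≢ = true≢false yu (only-ℓ y n i∈ i≢)

        closed′ : ∀ i → Closed (Y i) (hang′ i)
        closed′ i h with i Fin.≟ p | i Fin.≟ ℓ
        ... | yes refl | _    = merged-closed h
        ... | no _     | no _ = closed i h

        cover′ : ∀ {u v} → u ∈ᵇ A → v ∈ᵇ A → Touch u v →
                 (∃ λ i → i ∈ without ℓ L × u ∈ᵇ Y i × v ∈ᵇ Y i) ⊎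
                 (∃ λ i → u ∈ᵇ hang′ i ⊎ v ∈ᵇ hang′ i)
        cover′ u∈ v∈ uv with cover u∈ v∈ uv
        ... | inj₂ (i , inj₁ h) = inj₂ (proj₁ (hang-any i h) , inj₁ (proj₂ (hang-any i h)))
        ... | inj₂ (i , inj₂ h) = inj₂ (proj₁ (hang-any i h) , inj₂ (proj₂ (hang-any i h)))
        ... | inj₁ (i , i∈ , yu , yv) with i Fin.≟ ℓ
        ... | no i≢ = inj₁ (i , without-∈ i∈ i≢ , yu , yv)
        ... | yes refl with stay yu | stay yv
        ... | inj₁ e  | _       = inj₂ (p , inj₁ (at-p e))
        ... | inj₂ _  | inj₁ e  = inj₂ (p , inj₂ (at-p e))
        ... | inj₂ yp | inj₂ yq = inj₁ (p , without-∈ p∈ p≢ℓ , yp , yq)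

        -- By closedness, whatever in `A` touches `hang p` lies in `hang p` or `Y p`, and neither of
        -- them meets what is taken over from `ℓ`.
        apart : ∀ {u v} → u ∈ᵇ hang p → v ∈ᵇ hang ℓ ⊎ (v ∈ᵇ Y ℓ × Y p v ≡ false) → ¬ Touch u v
        apart h (inj₁ h′) uv with closed p h (hang⊆A h′) uv
        ... | inj₁ h″ = p≢ℓ (hang-disj h″ h′)
        ... | inj₂ y  = true≢false y (hang-gone h′ p∈)
        apart h (inj₂ (y , n)) uv with closed p h (Y⊆A y) uv
        ... | inj₁ h″ = true≢false y (hang-gone h″ ℓ∈)
        ... | inj₂ y′ = true≢false y′ n

        holds′ : ∀ i → i ∈ without ℓ L → Φ i (hang′ i)
        holds′ i i∈ with i Fin.≟ p | i Fin.≟ ℓ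
        ... | yes refl | _        = Φ-step p ℓ (holds p∈) (holds ℓ∈) hang⊆A hang⊆A (closed p) (closed ℓ) merged-closed apart
        ... | no _     | yes refl = contradiction refl (without-≢ L i∈)
        ... | no _     | no _     = holds (without-⊆ L i∈)

      run : ∀ k {x} L → length L ≤ k → x ∈ L → State L → Goal
      run zero    L len x∈ st = contradiction (ℕ.≤-trans (without-< x∈) len) λ ()
      run (suc k) L len x∈ st with has-leaf Tr adj? acyclic x∈
      ... | ℓ , ℓ∈ , inj₂ (p , p∈ , ℓp , only) =
        run k (without ℓ L) (ℕ.≤-pred (ℕ.≤-trans (without-< ℓ∈) len))
          (without-∈ p∈ λ { refl → irrefl ℓp }) (remove st ℓ∈ p∈ ℓp only)
      -- The remaining nodes are connected, so an isolated one is the last.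
      ... | ℓ , ℓ∈ , inj₁ isolated = ℓ , hang ℓ , holds ℓ∈ , all
        where
        open State st
        isℓ : ∀ {i} → i ∈ L → i ≡ ℓ
        isℓ i∈ = On-isolated treeOn isolated ℓ∈ tt i∈ tt
        all : ∀ {v} → v ∈ᵇ A → v ∈ᵇ Y ℓ ⊎ v ∈ᵇ hang ℓ
        all v∈ with cover v∈ v∈ touch-refl
        ... | inj₁ (i , i∈ , y , _) with isℓ i∈
        ... | refl = inj₁ y
        all v∈ | inj₂ (i , inj₁ h) with isℓ (hang-live h)
        ... | refl = inj₂ h
        all v∈ | inj₂ (i , inj₂ h) with isℓ (hang-live h)
        ... | refl = inj₂ h

      start : State (allFin m)
      start = record
        { hang = λ _ _ → false
        ; hang⊆A = λ () ; hang-gone = λ () ; hang-disj = λ () ; hang-live = λ ()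
        ; closed = λ _ ()
        ; cover = λ u∈ v∈ uv → let (i , yu , yv) = cobag u∈ v∈ uv in inj₁ (i , ∈-allFin i , yu , yv)
        ; holds = λ {i} _ → Φ-empty i
        ; treeOn = λ _ _ → Star.map (λ (a , s , t) → a , (∈-allFin _ , tt) , (∈-allFin _ , tt)) (connected tt tt)
        ; bagOn = λ v (_ , su) (_ , sv) → Star.map (λ (a , s , t) → a , (∈-allFin _ , s) , (∈-allFin _ , t)) (conn v su sv)
        }

    -- An induction principle for tree decompositions. It is stated for any `Φ` because it serves
    -- twice: for pieces of degree 0 and for balanced separators.
    eliminate : Goal
    eliminate = run (length (allFin m)) (allFin m) ℕ.≤-refl (∈-allFin nonempty) start

-- Sums and cochains modulo 2

⨁ : ℕ → (ℕ → Bool) → Bool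
⨁ zero    f = false
⨁ (suc n) f = f n xor ⨁ n f

⨁-cong : ∀ n {f g} → (∀ i → i < n → f i ≡ g i) → ⨁ n f ≡ ⨁ n g
⨁-cong zero    eq = refl
⨁-cong (suc n) eq = cong₂ _xor_ (eq n ℕ.≤-refl) (⨁-cong n λ i i<n → eq i (ℕ.m≤n⇒m≤1+n i<n))

⨁-false : ∀ n {f} → (∀ i → i < n → f i ≡ false) → ⨁ n f ≡ false
⨁-false zero    eq = refl
⨁-false (suc n) eq rewrite eq n ℕ.≤-refl = ⨁-false n λ i i<n → eq i (ℕ.m≤n⇒m≤1+n i<n)

xor-interchange : ∀ a b c d → (a xor b) xor (c xor d) ≡ (a xor c) xor (b xor d)
xor-interchange = solve 4 (λ a b c d → (a :+ b) :+ (c :+ d) := (a :+ c) :+ (b :+ d)) refl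

⨁-xor : ∀ n (f g : ℕ → Bool) → ⨁ n (λ i → f i xor g i) ≡ ⨁ n f xor ⨁ n g
⨁-xor zero    f g = refl
⨁-xor (suc n) f g = trans (cong ((f n xor g n) xor_) (⨁-xor n f g)) (xor-interchange (f n) (g n) _ _)

xor-telescope : ∀ a b c → (a xor b) xor (b xor c) ≡ a xor c
xor-telescope = solve 3 (λ a b c → (a :+ b) :+ (b :+ c) := a :+ c) refl

⨁-telescope : ∀ n (f : ℕ → Bool) → ⨁ n (λ i → f (suc i) xor f i) ≡ f n xor f 0
⨁-telescope zero    f = sym (Bool.xor-same (f 0))
⨁-telescope (suc n) f = trans (cong ((f (suc n) xor f n) xor_) (⨁-telescope n f)) (xor-telescope (f (suc n)) (f n) (f 0))

-- Simplicial coboundaries; modulo 2 there are no signs.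
δ₁ : {V : Set} → (V → V → Bool) → V → V → V → Bool
δ₁ k u v w = k v w xor (k u w xor k u v)

δ₂ : {V : Set} → (V → V → V → Bool) → V → V → V → V → Bool
δ₂ q u v w t = q v w t xor (q u w t xor (q u v t xor q u v w))

module Triangulation {V : Set} (pt : ℕ → ℕ → ℕ → V) (N : ℕ) where

  -- The six simplices are the monotone paths along the edges of the cube.
  cube : (V → V → V → V → Bool) → ℕ → ℕ → ℕ → Bool
  cube T x y z =
    (T o i ij s xor T o i ik s) xor ((T o j ij s xor T o j jk s) xor (T o k ik s xor T o k jk s))
    where
    o  = pt x y z
    i  = pt (suc x) y z
    j  = pt x (suc y) z
    k  = pt x y (suc z)
    ij = pt (suc x) (suc y) z
    ik = pt (suc x) y (suc z)
    jk = pt x (suc y) (suc z)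
    s  = pt (suc x) (suc y) (suc z)

  Σtet : (V → V → V → V → Bool) → Bool
  Σtet T = ⨁ N λ x → ⨁ N λ y → ⨁ N λ z → cube T x y z

  module _ (q : V → V → V → Bool) where
    -- `q` on the two triangles that make up the facet of a unit cube orthogonal to the named axis.
    X-square Y-square Z-square : ℕ → ℕ → ℕ → Bool
    X-square x y z = q (pt x y z) (pt x (suc y) z) (pt x (suc y) (suc z)) xor
                     q (pt x y z) (pt x y (suc z)) (pt x (suc y) (suc z))
    Y-square x y z = q (pt x y z) (pt (suc x) y z) (pt (suc x) y (suc z)) xor
                     q (pt x y z) (pt x y (suc z)) (pt (suc x) y (suc z))
    Z-square x y z = q (pt x y z) (pt (suc x) y z) (pt (suc x) (suc y) z) xor
                     q (pt x y z) (pt x (suc y) z) (pt (suc x) (suc y) z)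

    -- Each of the six triangles inside the cube belongs to two simplices and cancels; the twelve on
    -- the facets remain.
    cube-boundary : ∀ x y z → cube (δ₂ q) x y z ≡
      (X-square (suc x) y z xor X-square x y z) xor
      ((Y-square x (suc y) z xor Y-square x y z) xor (Z-square x y (suc z) xor Z-square x y z))
    cube-boundary x y z =
      solve 18 (λ oi-ij oi-ik oj-ij oj-jk ok-ik ok-jk i-ij-s i-ik-s j-ij-s j-jk-s k-ik-s k-jk-s
                  ois ojs oks oijs oiks ojks →
          (((i-ij-s :+ (oijs :+ (ois :+ oi-ij))) :+ (i-ik-s :+ (oiks :+ (ois :+ oi-ik)))) :+
          (((j-ij-s :+ (oijs :+ (ojs :+ oj-ij))) :+ (j-jk-s :+ (ojks :+ (ojs :+ oj-jk)))) :+
           ((k-ik-s :+ (oiks :+ (oks :+ ok-ik))) :+ (k-jk-s :+ (ojks :+ (oks :+ ok-jk)))))) :=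
          (((i-ij-s :+ i-ik-s) :+ (oj-jk :+ ok-jk)) :+
          (((j-ij-s :+ j-jk-s) :+ (oi-ik :+ ok-ik)) :+ ((k-ik-s :+ k-jk-s) :+ (oi-ij :+ oj-ij)))))
        refl
        (q o i ij) (q o i ik) (q o j ij) (q o j jk) (q o k ik) (q o k jk)
        (q i ij s) (q i ik s) (q j ij s) (q j jk s) (q k ik s) (q k jk s)
        (q o i s) (q o j s) (q o k s) (q o ij s) (q o ik s) (q o jk s)
      where
      o  = pt x y z
      i  = pt (suc x) y z
      j  = pt x (suc y) z
      k  = pt x y (suc z)
      ij = pt (suc x) (suc y) z
      ik = pt (suc x) y (suc z)
      jk = pt x (suc y) (suc z)
      s  = pt (suc x) (suc y) (suc z)

    -- Stokes: the facets between neighbouring unit cubes telescope along the axes. The hypotheses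
    -- clear five sides of the large cube, so only the side x = N is left.
    Σtet-boundary :
      (∀ y z → y < N → z < N → X-square 0 y z ≡ false) →
      (∀ x z → x < N → z < N → Y-square x N z ≡ false × Y-square x 0 z ≡ false) →
      (∀ x y → x < N → y < N → Z-square x y N ≡ false × Z-square x y 0 ≡ false) →
      Σtet (δ₂ q) ≡ ⨁ N λ y → ⨁ N λ z → X-square N y z
    Σtet-boundary x₀ y₀ z₀ = begin
      Σtet (δ₂ q)
        ≡⟨ (⨁-cong N λ x x< → ⨁-cong N λ y y< → begin
              (⨁ N λ z → cube (δ₂ q) x y z)
                ≡⟨ ⨁-cong N (λ z _ → cube-boundary x y z) ⟩
              (⨁ N λ z → dX x y z xor (dY x y z xor dZ x y z))
                ≡⟨ ⨁-xor N (dX x y) _ ⟩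
              ⨁ N (dX x y) xor (⨁ N λ z → dY x y z xor dZ x y z)
                ≡⟨ cong (⨁ N (dX x y) xor_) (⨁-xor N (dY x y) (dZ x y)) ⟩
              ⨁ N (dX x y) xor (⨁ N (dY x y) xor ⨁ N (dZ x y))
                ≡⟨ cong (λ t → ⨁ N (dX x y) xor (⨁ N (dY x y) xor t))
                     (trans (⨁-telescope N (Z-square x y)) (cong₂ _xor_ (proj₁ (z₀ x y x< y<)) (proj₂ (z₀ x y x< y<)))) ⟩
              ⨁ N (dX x y) xor (⨁ N (dY x y) xor false)
                ≡⟨ cong (⨁ N (dX x y) xor_) (Bool.xor-identityʳ _) ⟩
              ⨁ N (dX x y) xor ⨁ N (dY x y) ∎) ⟩
      (⨁ N λ x → ⨁ N λ y → ⨁ N (dX x y) xor ⨁ N (dY x y))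
        ≡⟨ (⨁-cong N λ x x< → begin
              (⨁ N λ y → ⨁ N (dX x y) xor ⨁ N (dY x y))
                ≡⟨ ⨁-xor N (λ y → ⨁ N (dX x y)) (λ y → ⨁ N (dY x y)) ⟩
              (⨁ N λ y → ⨁ N (dX x y)) xor (⨁ N λ y → ⨁ N (dY x y))
                ≡⟨ cong ((⨁ N λ y → ⨁ N (dX x y)) xor_) (begin
                     (⨁ N λ y → ⨁ N (dY x y))
                       ≡⟨ ⨁-cong N (λ y _ → ⨁-xor N (Y-square x (suc y)) (Y-square x y)) ⟩
                     (⨁ N λ y → ⨁ N (Y-square x (suc y)) xor ⨁ N (Y-square x y))
                       ≡⟨ ⨁-telescope N (λ y → ⨁ N (Y-square x y)) ⟩
                     ⨁ N (Y-square x N) xor ⨁ N (Y-square x 0)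
                       ≡⟨ cong₂ _xor_ (⨁-false N λ z z< → proj₁ (y₀ x z x< z<)) (⨁-false N λ z z< → proj₂ (y₀ x z x< z<)) ⟩
                     false ∎) ⟩
              (⨁ N λ y → ⨁ N (dX x y)) xor false
                ≡⟨ Bool.xor-identityʳ _ ⟩
              (⨁ N λ y → ⨁ N (dX x y))
                ≡⟨ (⨁-cong N λ y _ → ⨁-xor N (X-square (suc x) y) (X-square x y)) ⟩
              (⨁ N λ y → ⨁ N (X-square (suc x) y) xor ⨁ N (X-square x y))
                ≡⟨ ⨁-xor N (λ y → ⨁ N (X-square (suc x) y)) (λ y → ⨁ N (X-square x y)) ⟩
              sheet (suc x) xor sheet x ∎) ⟩
      (⨁ N λ x → sheet (suc x) xor sheet x)
        ≡⟨ ⨁-telescope N sheet ⟩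
      sheet N xor sheet 0
        ≡⟨ cong (sheet N xor_) (⨁-false N λ y y< → ⨁-false N λ z z< → x₀ y z y< z<) ⟩
      sheet N xor false
        ≡⟨ Bool.xor-identityʳ _ ⟩
      sheet N ∎
      where
      open ≡-Reasoning
      dX dY dZ : ℕ → ℕ → ℕ → Bool
      dX x y z = X-square (suc x) y z xor X-square x y z
      dY x y z = Y-square x (suc y) z xor Y-square x y z
      dZ x y z = Z-square x y (suc z) xor Z-square x y z
      sheet : ℕ → Bool
      sheet x = ⨁ N λ y → ⨁ N λ z → X-square x y z

  IsTet : (V → V → V → V → Set) → Set
  IsTet P = ∀ x y z → x < N → y < N → z < N →
    let o  = pt x y z
        i  = pt (suc x) y z
        j  = pt x (suc y) z
        k  = pt x y (suc z)
        ij = pt (suc x) (suc y) z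
        ik = pt (suc x) y (suc z)
        jk = pt x (suc y) (suc z)
        s  = pt (suc x) (suc y) (suc z)
    in (P o i ij s × P o i ik s) × (P o j ij s × P o j jk s) × (P o k ik s × P o k jk s)

  Σtet-cong : ∀ {T T′} → IsTet (λ u v w t → T u v w t ≡ T′ u v w t) → Σtet T ≡ Σtet T′
  Σtet-cong eq = ⨁-cong N λ x x< → ⨁-cong N λ y y< → ⨁-cong N λ z z< →
    let ((a , b) , (c , d) , (e , f)) = eq x y z x< y< z<
    in cong₂ _xor_ (cong₂ _xor_ a b) (cong₂ _xor_ (cong₂ _xor_ c d) (cong₂ _xor_ e f))

  Σtet-xor : ∀ T T′ → Σtet (λ u v w t → T u v w t xor T′ u v w t) ≡ Σtet T xor Σtet T′
  Σtet-xor T T′ = begin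
    Σtet (λ u v w t → T u v w t xor T′ u v w t)
      ≡⟨ (⨁-cong N λ x _ → ⨁-cong N λ y _ → ⨁-cong N λ z _ → cube-xor x y z) ⟩
    (⨁ N λ x → ⨁ N λ y → ⨁ N λ z → cube T x y z xor cube T′ x y z)
      ≡⟨ (⨁-cong N λ x _ → ⨁-cong N λ y _ → ⨁-xor N (cube T x y) (cube T′ x y)) ⟩
    (⨁ N λ x → ⨁ N λ y → ⨁ N (cube T x y) xor ⨁ N (cube T′ x y))
      ≡⟨ (⨁-cong N λ x _ → ⨁-xor N (λ y → ⨁ N (cube T x y)) (λ y → ⨁ N (cube T′ x y))) ⟩
    (⨁ N λ x → (⨁ N λ y → ⨁ N (cube T x y)) xor (⨁ N λ y → ⨁ N (cube T′ x y)))
      ≡⟨ ⨁-xor N (λ x → ⨁ N λ y → ⨁ N (cube T x y)) (λ x → ⨁ N λ y → ⨁ N (cube T′ x y)) ⟩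
    Σtet T xor Σtet T′ ∎
    where
    open ≡-Reasoning
    cube-xor : ∀ x y z → cube (λ u v w t → T u v w t xor T′ u v w t) x y z ≡ cube T x y z xor cube T′ x y z
    cube-xor x y z = solve 12 (λ a b c d e f a′ b′ c′ d′ e′ f′ →
      ((a :+ a′) :+ (b :+ b′)) :+ (((c :+ c′) :+ (d :+ d′)) :+ ((e :+ e′) :+ (f :+ f′))) :=
      ((a :+ b) :+ ((c :+ d) :+ (e :+ f))) :+ ((a′ :+ b′) :+ ((c′ :+ d′) :+ (e′ :+ f′)))) refl
      (T o i ij s) (T o i ik s) (T o j ij s) (T o j jk s) (T o k ik s) (T o k jk s)
      (T′ o i ij s) (T′ o i ik s) (T′ o j ij s) (T′ o j jk s) (T′ o k ik s) (T′ o k jk s)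
      where
      o  = pt x y z
      i  = pt (suc x) y z
      j  = pt x (suc y) z
      k  = pt x y (suc z)
      ij = pt (suc x) (suc y) z
      ik = pt (suc x) y (suc z)
      jk = pt x (suc y) (suc z)
      s  = pt (suc x) (suc y) (suc z)

  Σtet-false : ∀ {T} → IsTet (λ u v w t → T u v w t ≡ false) → Σtet T ≡ false
  Σtet-false {T} eq = trans (Σtet-cong {T} {λ _ _ _ _ → false} eq)
    (⨁-false N λ x _ → ⨁-false N λ y _ → ⨁-false N λ z _ → refl)

-- The cup product δb ∪ δc.
cup : {V : Set} → (V → Bool) → (V → Bool) → V → V → V → Bool
cup b c u v w = (b u xor b v) ∧ (c v xor c w)

module Cochains {V : Set} (B a : V → Bool) where

  -- The value of a at a vertex of the simplex in B if there is one, and at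
  -- its first vertex otherwise.  In the cases of interest a is constant on
  -- the vertices of a simplex in B.
  a₁ : V → V → Bool
  a₁ u v = if B u then a u else if B v then a v else a u

  a₂ : V → V → V → Bool
  a₂ u v w = if B u then a u else if B v then a v else if B w then a w else a u

  -- The coboundary of a ∪ δb ∪ δc with the vertices in B ordered first; its sum
  -- over all tetrahedra is a mapping degree.
  density : (b c : V → Bool) → V → V → V → V → Bool
  density b c = δ₂ (λ u v w → a₂ u v w ∧ cup b c u v w)

  -- Changing b or c changes cup b c by some δ₁ k; defect k is the resulting
  -- change of a ∪ cup b c up to a coboundary, and is supported off the
  -- simplices on which b and c are flat.
  defect : (V → V → Bool) → V → V → V → Bool
  defect k u v w = (a₂ u v w ∧ δ₁ k u v w) xor δ₁ (λ x y → a₁ x y ∧ k x y) u v w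

  Const-on : List V → Bool → Set
  Const-on l α = ∀ {x} → x ∈ l → x ∈ᵇ B → a x ≡ α

  const-on : ∀ l → (∀ {x y} → x ∈ l → y ∈ l → x ∈ᵇ B → y ∈ᵇ B → a x ≡ a y) → ∃ (Const-on l)
  const-on [] eq = true , λ ()
  const-on (u ∷ l) eq with decide (B u)
  ... | inj₁ Bu = a u , λ x∈ Bx → eq x∈ (here refl) Bx Bu
  ... | inj₂ ¬Bu with const-on l (λ x∈ y∈ → eq (there x∈) (there y∈))
  ... | α , c = α , λ { (here refl) Bx → true≢false Bx ¬Bu ; (there x∈) Bx → c x∈ Bx }

  a₁-const : ∀ {u v α} → Const-on (u ∷ v ∷ []) α → a₁ u v ≡ α ⊎ (B u ≡ false × B v ≡ false)
  a₁-const {u} {v} c with B u in Bu | B v in Bv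
  ... | true  | _     = inj₁ (c (here refl) Bu)
  ... | false | true  = inj₁ (c (there (here refl)) Bv)
  ... | false | false = inj₂ (refl , refl)

  a₂-const : ∀ {u v w α} → Const-on (u ∷ v ∷ w ∷ []) α →
             a₂ u v w ≡ α ⊎ (B u ≡ false × B v ≡ false × B w ≡ false)
  a₂-const {u} {v} {w} c with B u in Bu | B v in Bv | B w in Bw
  ... | true  | _     | _     = inj₁ (c (here refl) Bu)
  ... | false | true  | _     = inj₁ (c (there (here refl)) Bv)
  ... | false | false | true  = inj₁ (c (there (there (here refl))) Bw)
  ... | false | false | false = inj₂ (refl , refl , refl)

  private
    scale : ∀ {p α g} → p ≡ α ⊎ g ≡ false → p ∧ g ≡ α ∧ g
    scale (inj₁ refl) = refl
    scale {p} {α} (inj₂ refl) = trans (Bool.∧-zeroʳ p) (sym (Bool.∧-zeroʳ α))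

    cup-flat : ∀ {b c : V → Bool} {u v w} → b u ≡ b v → cup b c u v w ≡ false
    cup-flat {b} {v = v} e rewrite e | Bool.xor-same (b v) = refl

  -- On all faces `a₂` can be replaced by one constant `α`: faces that meet `B` have this value, and
  -- on the others `cup b c` is 0, as `b` is flat there. What remains is `α` times the coboundary of
  -- the cocycle `cup b c`.
  density-false : ∀ {b c} u v w t → let l = u ∷ v ∷ w ∷ t ∷ [] in
    (∀ {x y} → x ∈ l → y ∈ l → x ∈ᵇ B → y ∈ᵇ B → a x ≡ a y) →
    (∀ {x y} → x ∈ l → y ∈ l → B x ≡ false → B y ≡ false → b x ≡ b y) →
    density b c u v w t ≡ false
  density-false {b} {c} u v w t same flat with const-on (u ∷ v ∷ w ∷ t ∷ []) same
  ... | α , fits = trans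
    (cong₂ _xor_ (face v∈ w∈ t∈) (cong₂ _xor_ (face u∈ w∈ t∈) (cong₂ _xor_ (face u∈ v∈ t∈) (face u∈ v∈ w∈))))
    (cocycle α (b u) (b v) (b w) (c v) (c w) (c t))
    where
    l : List V
    l = u ∷ v ∷ w ∷ t ∷ []
    u∈ : u ∈ l
    u∈ = here refl
    v∈ : v ∈ l
    v∈ = there (here refl)
    w∈ : w ∈ l
    w∈ = there (there (here refl))
    t∈ : t ∈ l
    t∈ = there (there (there (here refl)))
    face : ∀ {x y z} → x ∈ l → y ∈ l → z ∈ l → a₂ x y z ∧ cup b c x y z ≡ α ∧ cup b c x y z
    face {x} {y} {z} x∈ y∈ z∈ with a₂-const {x} {y} {z} {α} (λ { (here refl) → fits x∈ ; (there (here refl)) → fits y∈ ; (there (there (here refl))) → fits z∈ })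
    ... | inj₁ e = scale {g = cup b c x y z} (inj₁ e)
    ... | inj₂ (Bx , By , _) = scale {a₂ x y z} {α} (inj₂ (cup-flat {b} {c} {x} {y} {z} (flat x∈ y∈ Bx By)))
    cocycle : ∀ α bu bv bw cv cw ct →
      (α ∧ ((bv xor bw) ∧ (cw xor ct))) xor ((α ∧ ((bu xor bw) ∧ (cw xor ct))) xor
      ((α ∧ ((bu xor bv) ∧ (cv xor ct))) xor (α ∧ ((bu xor bv) ∧ (cv xor cw))))) ≡ false
    cocycle = solve 7 (λ α bu bv bw cv cw ct →
      (α :* ((bv :+ bw) :* (cw :+ ct))) :+ ((α :* ((bu :+ bw) :* (cw :+ ct))) :+
      ((α :* ((bu :+ bv) :* (cv :+ ct))) :+ (α :* ((bu :+ bv) :* (cv :+ cw))))) := con false) refl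

  -- Once `a₁` and `a₂` are replaced by the same constant, the two terms of the defect are equal.
  defect-scale : ∀ {k u v w} α → a₂ u v w ≡ α ⊎ δ₁ k u v w ≡ false →
    a₁ v w ≡ α ⊎ k v w ≡ false → a₁ u w ≡ α ⊎ k u w ≡ false → a₁ u v ≡ α ⊎ k u v ≡ false →
    defect k u v w ≡ false
  defect-scale {k} {u} {v} {w} α f e₀ e₁ e₂ = trans
    (cong₂ _xor_ (scale f) (cong₂ _xor_ (scale e₀) (cong₂ _xor_ (scale e₁) (scale e₂))))
    (solve 4 (λ α x y z → (α :* (x :+ (y :+ z))) :+ ((α :* x) :+ ((α :* y) :+ (α :* z))) := con false) refl
      α (k v w) (k u w) (k u v))

  defect-flat : ∀ {k} u v w → let l = u ∷ v ∷ w ∷ [] in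
    (∀ {x y} → x ∈ l → y ∈ l → x ∈ᵇ B → y ∈ᵇ B → a x ≡ a y) →
    (∀ {x y} → x ∈ l → y ∈ l → B x ≡ false → B y ≡ false → k x y ≡ false) →
    defect k u v w ≡ false
  defect-flat {k} u v w same flat with const-on (u ∷ v ∷ w ∷ []) same
  ... | α , fits = defect-scale α face (edge v∈ w∈) (edge u∈ w∈) (edge u∈ v∈)
    where
    l : List V
    l = u ∷ v ∷ w ∷ []
    u∈ : u ∈ l
    u∈ = here refl
    v∈ : v ∈ l
    v∈ = there (here refl)
    w∈ : w ∈ l
    w∈ = there (there (here refl))
    edge : ∀ {x y} → x ∈ l → y ∈ l → a₁ x y ≡ α ⊎ k x y ≡ false
    edge {x} {y} x∈ y∈ with a₁-const {x} {y} {α} (λ { (here refl) → fits x∈ ; (there (here refl)) → fits y∈ })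
    ... | inj₁ e = inj₁ e
    ... | inj₂ (Bx , By) = inj₂ (flat x∈ y∈ Bx By)
    face : a₂ u v w ≡ α ⊎ δ₁ k u v w ≡ false
    face with a₂-const {u} {v} {w} {α} fits
    ... | inj₁ e = inj₁ e
    ... | inj₂ (Bu , Bv , Bw) = inj₂ (cong₂ _xor_ (flat v∈ w∈ Bv Bw) (cong₂ _xor_ (flat u∈ w∈ Bu Bw) (flat u∈ v∈ Bu Bv)))

  a₂-all : ∀ {x y z α} → a x ≡ α → a y ≡ α → a z ≡ α → a₂ x y z ≡ α
  a₂-all {x} {y} {z} p q r with B x | B y | B z
  ... | true  | _     | _     = p
  ... | false | true  | _     = q
  ... | false | false | true  = r
  ... | false | false | false = p

  defect-const : ∀ {k} u v w α → a u ≡ α → a v ≡ α → a w ≡ α → defect k u v w ≡ false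
  defect-const {k} u v w α p q r =
    defect-scale {k} α (inj₁ (a₂-all p q r)) (inj₁ (a₁≡ q r)) (inj₁ (a₁≡ p r)) (inj₁ (a₁≡ p q))
    where
    a₁≡ : ∀ {x y} → a x ≡ α → a y ≡ α → a₁ x y ≡ α
    a₁≡ {x} {y} p q with B x | B y
    ... | true  | _     = p
    ... | false | true  = q
    ... | false | false = p

  -- `defect k` differs from `a₂ ∧ δ₁ k` by a coboundary, which a second coboundary kills.
  density-change : ∀ {b c b′ c′ : V → Bool} {k} →
    (∀ u v w → cup b c u v w xor cup b′ c′ u v w ≡ δ₁ k u v w) →
    ∀ u v w t → density b c u v w t xor density b′ c′ u v w t ≡ δ₂ (defect k) u v w t
  density-change {b} {c} {b′} {c′} {k} eq u v w t = begin
    density b c u v w t xor density b′ c′ u v w t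
      ≡⟨ solve 12 (λ p q r s g₁ g₂ g₃ g₄ g₁′ g₂′ g₃′ g₄′ →
           ((p :* g₁) :+ ((q :* g₂) :+ ((r :* g₃) :+ (s :* g₄)))) :+
           ((p :* g₁′) :+ ((q :* g₂′) :+ ((r :* g₃′) :+ (s :* g₄′)))) :=
           (p :* (g₁ :+ g₁′)) :+ ((q :* (g₂ :+ g₂′)) :+ ((r :* (g₃ :+ g₃′)) :+ (s :* (g₄ :+ g₄′))))) refl
           (a₂ v w t) (a₂ u w t) (a₂ u v t) (a₂ u v w)
           (cup b c v w t) (cup b c u w t) (cup b c u v t) (cup b c u v w)
           (cup b′ c′ v w t) (cup b′ c′ u w t) (cup b′ c′ u v t) (cup b′ c′ u v w) ⟩
    δ₂ (λ u v w → a₂ u v w ∧ (cup b c u v w xor cup b′ c′ u v w)) u v w t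
      ≡⟨ cong₂ _xor_ (face v w t) (cong₂ _xor_ (face u w t) (cong₂ _xor_ (face u v t) (face u v w))) ⟩
    δ₂ (λ u v w → a₂ u v w ∧ δ₁ k u v w) u v w t
      ≡⟨ solve 10 (λ f₁ f₂ f₃ f₄ uv uw ut vw vt wt →
           f₁ :+ (f₂ :+ (f₃ :+ f₄)) :=
           (f₁ :+ (wt :+ (vt :+ vw))) :+ ((f₂ :+ (wt :+ (ut :+ uw))) :+
           ((f₃ :+ (vt :+ (ut :+ uv))) :+ (f₄ :+ (vw :+ (uw :+ uv)))))) refl
           (F v w t) (F u w t) (F u v t) (F u v w) (E u v) (E u w) (E u t) (E v w) (E v t) (E w t) ⟩
    δ₂ (defect k) u v w t ∎
    where
    open ≡-Reasoning
    F : V → V → V → Bool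
    F u v w = a₂ u v w ∧ δ₁ k u v w
    E : V → V → Bool
    E u v = a₁ u v ∧ k u v
    face : ∀ u v w → a₂ u v w ∧ (cup b c u v w xor cup b′ c′ u v w) ≡ F u v w
    face u v w = cong (a₂ u v w ∧_) (eq u v w)

-- With β = b + b′ this is δβ ∪ δc = δ(β ∪ δc), which holds since δδc = 0.
cup-change₁ : {V : Set} (b b′ c : V → Bool) → ∀ u v w →
  cup b c u v w xor cup b′ c u v w ≡ δ₁ (λ x y → (b x xor b′ x) ∧ (c x xor c y)) u v w
cup-change₁ b b′ c u v w = solve 7 (λ bu bv bu′ bv′ cu cv cw →
  ((bu :+ bv) :* (cv :+ cw)) :+ ((bu′ :+ bv′) :* (cv :+ cw)) :=
  ((bv :+ bv′) :* (cv :+ cw)) :+ (((bu :+ bu′) :* (cu :+ cw)) :+ ((bu :+ bu′) :* (cu :+ cv)))) refl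
  (b u) (b v) (b′ u) (b′ v) (c u) (c v) (c w)

-- Likewise δb ∪ δγ = δ(δb ∪ γ) for γ = c + c′.
cup-change₂ : {V : Set} (b c c′ : V → Bool) → ∀ u v w →
  cup b c u v w xor cup b c′ u v w ≡ δ₁ (λ x y → (b x xor b y) ∧ (c y xor c′ y)) u v w
cup-change₂ b c c′ u v w = solve 7 (λ bu bv bw cv cw cv′ cw′ →
  ((bu :+ bv) :* (cv :+ cw)) :+ ((bu :+ bv) :* (cv′ :+ cw′)) :=
  ((bv :+ bw) :* (cw :+ cw′)) :+ (((bu :+ bw) :* (cw :+ cw′)) :+ ((bu :+ bv) :* (cv :+ cv′)))) refl
  (b u) (b v) (b w) (c v) (c w) (c′ v) (c′ w)

-- The triangulated cube

-- Adjacency in `Q n` or equality, so that any two vertices of a simplex touch, including a vertex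
-- and itself.
Touch : {n : ℕ} → Vertex n → Vertex n → Set
Touch u v = u ⊑ v ⊎ v ⊑ u

≲-refl : {n : ℕ} {i : Fin n} → i ≲ i
≲-refl = ℕ.≤-refl , ℕ.n≤1+n _

touch-refl : {n : ℕ} {v : Vertex n} → Touch v v
touch-refl = inj₁ (≲-refl , ≲-refl , ≲-refl)

touch-sym : {n : ℕ} {u v : Vertex n} → Touch u v → Touch v u
touch-sym = swap

-- |m - n| ≤ d, without truncated subtraction.
Close : ℕ → ℕ → ℕ → Set
Close d m n = m ≤ d + n × n ≤ d + m

xc yc zc : {n : ℕ} → Vertex n → ℕ
xc (x , _ , _) = toℕ x
yc (_ , y , _) = toℕ y
zc (_ , _ , z) = toℕ z

≲-close : {n : ℕ} {i j : Fin n} → i ≲ j → Close 1 (toℕ i) (toℕ j)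
≲-close (i≤j , j≤) = ℕ.m≤n⇒m≤1+n i≤j , j≤

touch-close : {n : ℕ} {u v : Vertex n} → Touch u v →
  Close 1 (xc u) (xc v) × Close 1 (yc u) (yc v) × Close 1 (zc u) (zc v)
touch-close (inj₁ (x , y , z)) = ≲-close x , ≲-close y , ≲-close z
touch-close (inj₂ (x , y , z)) = ×.swap (≲-close x) , ×.swap (≲-close y) , ×.swap (≲-close z)

Near : {n : ℕ} → ℕ → Vertex n → Vertex n → Set
Near d u v = Close d (xc u) (xc v) × Close d (yc u) (yc v) × Close d (zc u) (zc v)

_≤ᶠ_ : ℕ → ℕ → Bool
m ≤ᶠ n = does (m ℕ.≤? n)

module Level {n D : ℕ} (rep : Vertex n → Vertex n) (coord : Vertex n → ℕ)
  (near : ∀ v → Close D (coord v) (coord (rep v)))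
  (step : ∀ {u v} → Touch u v → Close 1 (coord u) (coord v))
  (S : Vertex n → Bool) where

  -- `D` allows for the displacement by `rep`, and the extra 1 for passing to a vertex that touches
  -- `u`.
  Far : ℕ → Vertex n → Set
  Far j u = suc D + coord u < j ⊎ suc D + j ≤ coord u

  abstract
    -- Inside `S` the coordinate is read at the representative. The half-spaces `level j` thus never
    -- separate vertices of `S` with the same representative, at the price of moving their boundary
    -- by at most `D`.
    moved-coord : Vertex n → ℕ
    moved-coord v = coord (if S v then rep v else v)

    level : ℕ → Vertex n → Bool
    level j v = j ≤ᶠ moved-coord v

    moved-close : ∀ v → Close D (coord v) (moved-coord v)
    moved-close v with S v
    ... | true  = near v
    ... | false = ℕ.m≤n+m _ D , ℕ.m≤n+m _ D

    level-true : ∀ {j v} → D + j ≤ coord v → level j v ≡ true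
    level-true {j} {v} le = dec-true (j ℕ.≤? moved-coord v)
      (ℕ.+-cancelˡ-≤ D j _ (ℕ.≤-trans le (proj₁ (moved-close v))))

    level-false : ∀ {j v} → D + coord v < j → level j v ≡ false
    level-false {j} {v} lt = dec-false (j ℕ.≤? moved-coord v)
      (ℕ.<⇒≱ (ℕ.≤-<-trans (proj₂ (moved-close v)) lt))

    level-far : ∀ {j u v} → Far j u → Touch u v → level j u ≡ level j v
    level-far {j} {u} {v} (inj₁ lt) uv =
      trans (level-false (ℕ.<-trans (ℕ.n<1+n _) lt))
        (sym (level-false (ℕ.≤-<-trans (ℕ.≤-trans (ℕ.+-monoʳ-≤ D (proj₂ (step uv))) (ℕ.≤-reflexive (ℕ.+-suc D _))) lt)))
    level-far {j} {u} {v} (inj₂ le) uv =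
      trans (level-true (ℕ.≤-trans (ℕ.n≤1+n _) le))
        (sym (level-true (ℕ.≤-pred (ℕ.≤-trans le (proj₁ (step uv))))))

    level-cong : ∀ {j u v} → S u ≡ true → S v ≡ true → rep u ≡ rep v → level j u ≡ level j v
    level-cong su sv e rewrite su | sv | e = refl

-- Total, so that sums over the grid carry no bounds; it alters only arguments above `N`.
clamp : {N : ℕ} → ℕ → Fin (suc N)
clamp {N} k = fromℕ< (s≤s (ℕ.m⊓n≤n k N))

toℕ-clamp : ∀ {N k} → k ≤ N → toℕ (clamp {N} k) ≡ k
toℕ-clamp {N} {k} k≤N = trans (Fin.toℕ-fromℕ< _) (ℕ.m≤n⇒m⊓n≡m k≤N)

clamp-≲ : ∀ {N k} → k < N → clamp {N} k ≲ clamp (suc k)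
clamp-≲ k<N rewrite toℕ-clamp (ℕ.<⇒≤ k<N) | toℕ-clamp k<N = ℕ.n≤1+n _ , ℕ.≤-refl

pt : {N : ℕ} → ℕ → ℕ → ℕ → Vertex (suc N)
pt x y z = clamp x , clamp y , clamp z

Clique : {n : ℕ} → List (Vertex n) → Set
Clique l = ∀ {u v} → u ∈ l → v ∈ l → Touch u v

module _ {N : ℕ} where
  open Triangulation (pt {N}) N

  -- The corners of a simplex lie on a monotone path and are comparable in pairs. As `⊑` is not
  -- transitive, each of the six comparisons is supplied.
  tet-cliques : ∀ {P : (u v w t : Vertex (suc N)) → Set} →
    (∀ u v w t → Clique (u ∷ v ∷ w ∷ t ∷ []) → P u v w t) → IsTet P
  tet-cliques f x y z x< y< z< =
    (f _ _ _ _ (chain (X , ≲-refl , ≲-refl) (X , Y , ≲-refl) (X , Y , Z) (≲-refl , Y , ≲-refl) (≲-refl , Y , Z) (≲-refl , ≲-refl , Z)) ,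
     f _ _ _ _ (chain (X , ≲-refl , ≲-refl) (X , ≲-refl , Z) (X , Y , Z) (≲-refl , ≲-refl , Z) (≲-refl , Y , Z) (≲-refl , Y , ≲-refl))) ,
    (f _ _ _ _ (chain (≲-refl , Y , ≲-refl) (X , Y , ≲-refl) (X , Y , Z) (X , ≲-refl , ≲-refl) (X , ≲-refl , Z) (≲-refl , ≲-refl , Z)) ,
     f _ _ _ _ (chain (≲-refl , Y , ≲-refl) (≲-refl , Y , Z) (X , Y , Z) (≲-refl , ≲-refl , Z) (X , ≲-refl , Z) (X , ≲-refl , ≲-refl))) ,
    (f _ _ _ _ (chain (≲-refl , ≲-refl , Z) (X , ≲-refl , Z) (X , Y , Z) (X , ≲-refl , ≲-refl) (X , Y , ≲-refl) (≲-refl , Y , ≲-refl)) ,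
     f _ _ _ _ (chain (≲-refl , ≲-refl , Z) (≲-refl , Y , Z) (X , Y , Z) (≲-refl , Y , ≲-refl) (X , Y , ≲-refl) (X , ≲-refl , ≲-refl)))
    where
    X = clamp-≲ x<
    Y = clamp-≲ y<
    Z = clamp-≲ z<
    chain : ∀ {u v w t : Vertex (suc N)} → u ⊑ v → u ⊑ w → u ⊑ t → v ⊑ w → v ⊑ t → w ⊑ t →
            Clique (u ∷ v ∷ w ∷ t ∷ [])
    chain uv uw ut vw vt wt = λ where
      (here refl) (here refl) → touch-refl
      (here refl) (there (here refl)) → inj₁ uv
      (here refl) (there (there (here refl))) → inj₁ uw
      (here refl) (there (there (there (here refl)))) → inj₁ ut
      (there (here refl)) (here refl) → inj₂ uv
      (there (here refl)) (there (here refl)) → touch-refl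
      (there (here refl)) (there (there (here refl))) → inj₁ vw
      (there (here refl)) (there (there (there (here refl)))) → inj₁ vt
      (there (there (here refl))) (here refl) → inj₂ uw
      (there (there (here refl))) (there (here refl)) → inj₂ vw
      (there (there (here refl))) (there (there (here refl))) → touch-refl
      (there (there (here refl))) (there (there (there (here refl)))) → inj₁ wt
      (there (there (there (here refl)))) (here refl) → inj₂ ut
      (there (there (there (here refl)))) (there (here refl)) → inj₂ vt
      (there (there (there (here refl)))) (there (there (here refl))) → inj₂ wt
      (there (there (there (here refl)))) (there (there (there (here refl)))) → touch-refl

-- The planar instance of the degree computation.
cup-square-sum : {V : Set} (N : ℕ) (p : ℕ → ℕ → V) (b c : V → Bool) →
  (∀ z → z ≤ N → b (p 0 z) ≡ false × b (p N z) ≡ true) →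
  (∀ y → y ≤ N → c (p y 0) ≡ false × c (p y N) ≡ true) →
  (⨁ N λ y → ⨁ N λ z →
    cup b c (p y z) (p (suc y) z) (p (suc y) (suc z)) xor
    cup b c (p y z) (p y (suc z)) (p (suc y) (suc z))) ≡ true
cup-square-sum N p b c b-end c-end = begin
  (⨁ N λ y → ⨁ N λ z → square y z)
    ≡⟨ (⨁-cong N λ y y< → begin
          (⨁ N λ z → square y z)
            ≡⟨ ⨁-cong N (λ z _ → split y z) ⟩
          (⨁ N λ z → (K (suc y) z xor K y z) xor (L y (suc z) xor L y z))
            ≡⟨ ⨁-xor N (λ z → K (suc y) z xor K y z) (λ z → L y (suc z) xor L y z) ⟩
          (⨁ N λ z → K (suc y) z xor K y z) xor (⨁ N λ z → L y (suc z) xor L y z)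
            ≡⟨ cong₂ _xor_ (⨁-xor N (K (suc y)) (K y))
                 (trans (⨁-telescope N (L y)) (cong₂ _xor_ (L-const y< c-end₁) (L-const y< c-end₀))) ⟩
          (⨁ N (K (suc y)) xor ⨁ N (K y)) xor false
            ≡⟨ Bool.xor-identityʳ _ ⟩
          ⨁ N (K (suc y)) xor ⨁ N (K y) ∎) ⟩
  (⨁ N λ y → ⨁ N (K (suc y)) xor ⨁ N (K y))
    ≡⟨ ⨁-telescope N (λ y → ⨁ N (K y)) ⟩
  ⨁ N (K N) xor ⨁ N (K 0)
    ≡⟨ cong₂ _xor_
         (⨁-cong N λ z z< → trans (cong (_∧ (c (p N z) xor c (p N (suc z)))) (proj₂ (b-end z (ℕ.<⇒≤ z<)))) (Bool.xor-comm _ (c (p N (suc z)))))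
         (⨁-false N λ z z< → cong (_∧ (c (p 0 z) xor c (p 0 (suc z)))) (proj₁ (b-end z (ℕ.<⇒≤ z<)))) ⟩
  (⨁ N λ z → c (p N (suc z)) xor c (p N z)) xor false
    ≡⟨ Bool.xor-identityʳ _ ⟩
  (⨁ N λ z → c (p N (suc z)) xor c (p N z))
    ≡⟨ ⨁-telescope N (λ z → c (p N z)) ⟩
  c (p N N) xor c (p N 0)
    ≡⟨ cong₂ _xor_ (c-end₁ ℕ.≤-refl) (c-end₀ ℕ.≤-refl) ⟩
  true ∎
  where
  open ≡-Reasoning
  -- `k` is b ∪ δc, whose coboundary is `cup b c`. Summed over the sides of all squares it leaves
  -- the boundary of the large square, where only the side y = N contributes: there `b` is 1 and `c`
  -- rises from 0 to 1.
  k : _ → _ → Bool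
  k u v = b u ∧ (c u xor c v)
  K L : ℕ → ℕ → Bool
  K y z = k (p y z) (p y (suc z))
  L y z = k (p y z) (p (suc y) z)
  square : ℕ → ℕ → Bool
  square y z = cup b c (p y z) (p (suc y) z) (p (suc y) (suc z)) xor
               cup b c (p y z) (p y (suc z)) (p (suc y) (suc z))
  split : ∀ y z → square y z ≡ (K (suc y) z xor K y z) xor (L y (suc z) xor L y z)
  split y z = solve 7 (λ bo bj bk co cj ck cs →
    ((bo :+ bj) :* (cj :+ cs)) :+ ((bo :+ bk) :* (ck :+ cs)) :=
    ((bj :* (cj :+ cs)) :+ (bo :* (co :+ ck))) :+ ((bk :* (ck :+ cs)) :+ (bo :* (co :+ cj)))) refl
    (b (p y z)) (b (p (suc y) z)) (b (p y (suc z)))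
    (c (p y z)) (c (p (suc y) z)) (c (p y (suc z))) (c (p (suc y) (suc z)))
  c-end₀ : ∀ {y} → y ≤ N → c (p y 0) ≡ false
  c-end₀ y≤ = proj₁ (c-end _ y≤)
  c-end₁ : ∀ {y} → y ≤ N → c (p y N) ≡ true
  c-end₁ y≤ = proj₂ (c-end _ y≤)
  L-const : ∀ {y z α} → y < N → (∀ {y} → y ≤ N → c (p y z) ≡ α) → L y z ≡ false
  L-const {y} {z} {α} y< e = trans
    (cong (b (p y z) ∧_) (trans (cong₂ _xor_ (e (ℕ.<⇒≤ y<)) (e y<)) (Bool.xor-same α)))
    (Bool.∧-zeroʳ (b (p y z)))

-- The degree of a set of vertices

any-true : {V : Set} {H : V → Bool} {l : List V} {v : V} → v ∈ l → v ∈ᵇ H → any H l ≡ true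
any-true (here refl) h = ∨-inl h
any-true {H = H} {l = u ∷ _} (there v∈) h = ∨-inr {H u} (any-true v∈ h)

any-inv : {V : Set} {H : V → Bool} (l : List V) → any H l ≡ true → ∃ λ v → v ∈ l × v ∈ᵇ H
any-inv (u ∷ l) e with ∨-inv e
... | inj₁ h = u , here refl , h
... | inj₂ e′ with any-inv l e′
... | v , v∈ , h = v , there v∈ , h

any-false : {V : Set} {H : V → Bool} (l : List V) → (∀ {v} → v ∈ l → v ∈ᵇ H → ⊥) → any H l ≡ false
any-false {H = H} l ¬h with any H l in e
... | false = refl
... | true  = let (v , v∈ , h) = any-inv l e in ⊥-elim (¬h v∈ h)

xor-≡ : ∀ {x y} → x xor y ≡ false → x ≡ y
xor-≡ {true}  {true}  _ = refl
xor-≡ {false} {false} _ = refl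

≡-xor : ∀ {x y} → x ≡ y → x xor y ≡ false
≡-xor {x} refl = Bool.xor-same x

∧-falseʳ : ∀ x {y} → y ≡ false → x ∧ y ≡ false
∧-falseʳ x refl = Bool.∧-zeroʳ x

-- `A` is the part that has the tree decomposition, and `χ` colours the other part, with `rep`
-- constant on its monochromatic components.
module Degree {N D : ℕ} (A χ : Vertex (suc N) → Bool) (rep : Vertex (suc N) → Vertex (suc N))
  (near : ∀ v → Near D v (rep v))
  (rep-const : ∀ {u v} → A u ≡ false → A v ≡ false → Touch u v → χ u ≡ χ v → rep u ≡ rep v)
  where

  private
    V : Set
    V = Vertex (suc N)

  open Triangulation (pt {N}) N

  B X : V → Bool
  B v = not (A v) ∧ χ v
  X v = not (A v) ∧ not (χ v)

  private
    module LX = Level rep xc (λ v → proj₁ (near v)) (λ t → proj₁ (touch-close t)) B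
    module LY = Level rep yc (λ v → proj₁ (proj₂ (near v))) (λ t → proj₁ (proj₂ (touch-close t))) X
    module LZ = Level rep zc (λ v → proj₂ (proj₂ (near v))) (λ t → proj₂ (proj₂ (touch-close t))) X

  b c : ℕ → V → Bool
  b = LY.level
  c = LZ.level

  -- The plane of `a` is fixed at the first position that is sure to keep `a` zero on the side x =
  -- 0. Only the planes of `b` and `c` are moved.
  open Cochains B (LX.level (suc D)) public

  -- Positions so far from both sides of the cube that the displacement by `rep` cannot affect the
  -- values there.
  Range : ℕ → Set
  Range j = suc D ≤ j × D + j ≤ N

  Avoids : (V → Bool) → ℕ → ℕ → Set
  Avoids Y j k = ∀ {u} → u ∈ᵇ Y → LY.Far j u × LZ.Far k u

  Closed : (Y H : V → Bool) → Set
  Closed Y H = ∀ {u v} → u ∈ᵇ H → v ∈ᵇ A → Touch u v → v ∈ᵇ H ⊎ v ∈ᵇ Y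

  private
    a : V → Bool
    a = LX.level (suc D)

    B-inv : ∀ {v} → v ∈ᵇ B → A v ≡ false × χ v ≡ true
    B-inv e = not-true (proj₁ (∧-inv e)) , proj₂ (∧-inv e)

    to-X : ∀ {v} → A v ≡ false → B v ≡ false → v ∈ᵇ X × χ v ≡ false
    to-X {v} ¬a ¬b with A v | χ v
    to-X () _  | true  | _
    to-X _  () | false | true
    to-X _  _  | false | false = refl , refl

    same : ∀ {x y} → Touch x y → x ∈ᵇ B → y ∈ᵇ B → a x ≡ a y
    same xy Bx By = let (ax , cx) = B-inv Bx ; (ay , cy) = B-inv By in
      LX.level-cong Bx By (rep-const ax ay xy (trans cx (sym cy)))

    -- Either both ends lie in `X` and have the same representative, or one end lies in `Y`, far
    -- from both planes.
    flat : ∀ {Y j k x y} → Avoids Y j k → Touch x y → B x ≡ false → B y ≡ false →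
           (x ∈ᵇ A → x ∈ᵇ Y) → (y ∈ᵇ A → y ∈ᵇ Y) → b j x ≡ b j y × c k x ≡ c k y
    flat {x = x} {y} av xy Bx By x∈ y∈ with decide (A x)
    ... | inj₁ Ax = let (f , g) = av (x∈ Ax) in LY.level-far f xy , LZ.level-far g xy
    ... | inj₂ ax with decide (A y)
    ... | inj₁ Ay = let (f , g) = av (y∈ Ay) in
      sym (LY.level-far f (touch-sym xy)) , sym (LZ.level-far g (touch-sym xy))
    ... | inj₂ ay with to-X ax Bx | to-X ay By
    ... | Xx , cx | Xy , cy =
      let e = rep-const ax ay xy (trans cx (sym cy)) in LY.level-cong Xx Xy e , LZ.level-cong Xx Xy e

    a-left : ∀ y z → a (pt 0 y z) ≡ false
    a-left y z = LX.level-false (s≤s (ℕ.≤-reflexive (ℕ.+-identityʳ D)))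

    at : ∀ {j} → Range j → D + j ≤ toℕ (clamp {N} N)
    at (_ , le) = subst (_ ≤_) (sym (toℕ-clamp ℕ.≤-refl)) le

    from : ∀ {j} → Range j → D + 0 < j
    from (lt , _) = subst (_< _) (sym (ℕ.+-identityʳ D)) lt

    b-front : ∀ {j} → Range j → ∀ x z → b j (pt x 0 z) ≡ false
    b-front r x z = LY.level-false (from r)

    b-back : ∀ {j} → Range j → ∀ x z → b j (pt x N z) ≡ true
    b-back r x z = LY.level-true (at r)

    c-bottom : ∀ {k} → Range k → ∀ x y → c k (pt x y 0) ≡ false
    c-bottom r x y = LZ.level-false (from r)

    c-top : ∀ {k} → Range k → ∀ x y → c k (pt x y N) ≡ true
    c-top r x y = LZ.level-true (at r)

    a-right : ∀ {j} → Range j → ∀ y z → a (pt N y z) ≡ true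
    a-right {j} (lt , le) y z = LX.level-true (at (ℕ.≤-refl , ℕ.≤-trans (ℕ.+-monoʳ-≤ D lt) le))

  density-avoiding : ∀ {Y j k} → Avoids Y j k → ∀ u v w t → Clique (u ∷ v ∷ w ∷ t ∷ []) →
    (∀ {x} → x ∈ (u ∷ v ∷ w ∷ t ∷ []) → x ∈ᵇ A → x ∈ᵇ Y) → density (b j) (c k) u v w t ≡ false
  density-avoiding {j = j} {k} av u v w t clique A⊆Y =
    density-false {b j} {c k} u v w t (λ x∈ y∈ → same (clique x∈ y∈))
      (λ x∈ y∈ Bx By → proj₁ (flat av (clique x∈ y∈) Bx By (A⊆Y x∈) (A⊆Y y∈)))

  -- Stokes leaves one side: `a` is 0 at x = 0, and at the ends of the other two axes `b` or `c` is
  -- constant. At x = N, where `a` is 1, the planar sum remains.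
  density-total : ∀ {j k} → Range j → Range k → Σtet (density (b j) (c k)) ≡ true
  density-total {j} {k} rj rk = trans
    (Σtet-boundary (λ u v w → a₂ u v w ∧ cup (b j) (c k) u v w)
      (λ y z _ _ → cong₂ _xor_
        (on-left (a-left _ _) (a-left _ _) (a-left _ _))
        (on-left (a-left _ _) (a-left _ _) (a-left _ _)))
      (λ x z _ _ → cong₂ _xor_ (in-b (b-back rj _ _) (b-back rj _ _)) (in-b (b-back rj _ _) (b-back rj _ _)) ,
                   cong₂ _xor_ (in-b (b-front rj _ _) (b-front rj _ _)) (in-b (b-front rj _ _) (b-front rj _ _)))
      (λ x y _ _ → cong₂ _xor_ (in-c (c-top rk _ _) (c-top rk _ _)) (in-c (c-top rk _ _) (c-top rk _ _)) ,
                   cong₂ _xor_ (in-c (c-bottom rk _ _) (c-bottom rk _ _)) (in-c (c-bottom rk _ _) (c-bottom rk _ _))))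
    (trans
      (⨁-cong N λ y _ → ⨁-cong N λ z _ → cong₂ _xor_
        (on-right (a-right rj _ _) (a-right rj _ _) (a-right rj _ _))
        (on-right (a-right rj _ _) (a-right rj _ _) (a-right rj _ _)))
      (cup-square-sum N (pt N) (b j) (c k)
        (λ z _ → b-front rj _ _ , b-back rj _ _) (λ y _ → c-bottom rk _ _ , c-top rk _ _)))
    where
    on-left : ∀ {u v w} → a u ≡ false → a v ≡ false → a w ≡ false → a₂ u v w ∧ cup (b j) (c k) u v w ≡ false
    on-left {u} {v} {w} p q r = cong (_∧ cup (b j) (c k) u v w) (a₂-all {u} {v} {w} p q r)
    on-right : ∀ {u v w} → a u ≡ true → a v ≡ true → a w ≡ true → a₂ u v w ∧ cup (b j) (c k) u v w ≡ cup (b j) (c k) u v w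
    on-right {u} {v} {w} p q r = cong (_∧ cup (b j) (c k) u v w) (a₂-all {u} {v} {w} p q r)
    in-b : ∀ {u v w α} → b j u ≡ α → b j v ≡ α → a₂ u v w ∧ cup (b j) (c k) u v w ≡ false
    in-b {u} {v} {w} p q = ∧-falseʳ (a₂ u v w) (cong (_∧ (c k v xor c k w)) (≡-xor (trans p (sym q))))
    in-c : ∀ {u v w α} → c k v ≡ α → c k w ≡ α → a₂ u v w ∧ cup (b j) (c k) u v w ≡ false
    in-c {u} {v} {w} p q = ∧-falseʳ (a₂ u v w) (∧-falseʳ (b j u xor b j v) (≡-xor (trans p (sym q))))

  weight : (V → Bool) → ℕ → ℕ → V → V → V → V → Bool
  weight H j k u v w t = any H (u ∷ v ∷ w ∷ t ∷ []) ∧ density (b j) (c k) u v w t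

  degree : (V → Bool) → ℕ → ℕ → Bool
  degree H j k = Σtet (weight H j k)

  private
    -- The change of the degree is the sum of `δ₂ G`, where `G` is the defect cut down to the
    -- triangles that meet `H`. By Stokes it is 0: on the two sides orthogonal to the first axis `a`
    -- is constant, and on the others `K` vanishes.
    degree-change : ∀ {Y H j k j′ k′ K} → Closed Y H →
      (∀ u v w → cup (b j) (c k) u v w xor cup (b j′) (c k′) u v w ≡ δ₁ K u v w) →
      (∀ {x y} → Touch x y → B x ≡ false → B y ≡ false → (x ∈ᵇ A → x ∈ᵇ Y) → (y ∈ᵇ A → y ∈ᵇ Y) → K x y ≡ false) →
      (∀ x z x′ z′ → K (pt x N z) (pt x′ N z′) ≡ false × K (pt x 0 z) (pt x′ 0 z′) ≡ false) →
      (∀ x y x′ y′ → K (pt x y N) (pt x′ y′ N) ≡ false × K (pt x y 0) (pt x′ y′ 0) ≡ false) →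
      ∀ {i} → Range i →
      degree H j k ≡ degree H j′ k′
    degree-change {Y} {H} {j} {k} {j′} {k′} {K} closed change K-flat Kʸ Kᶻ ri = xor-≡ (begin
      degree H j k xor degree H j′ k′
        ≡⟨ Σtet-xor (weight H j k) (weight H j′ k′) ⟨
      Σtet (λ u v w t → weight H j k u v w t xor weight H j′ k′ u v w t)
        ≡⟨ Σtet-cong {λ u v w t → weight H j k u v w t xor weight H j′ k′ u v w t} {δ₂ G} (tet-cliques same-weight) ⟩
      Σtet (δ₂ G)
        ≡⟨ Σtet-boundary G
             (λ y z _ _ → cong₂ _xor_ (G-const (a-left _ _) (a-left _ _) (a-left _ _)) (G-const (a-left _ _) (a-left _ _) (a-left _ _)))
             (λ x z _ _ → cong₂ _xor_ (G-edges (proj₁ (Kʸ _ _ _ _)) (proj₁ (Kʸ _ _ _ _)) (proj₁ (Kʸ _ _ _ _))) (G-edges (proj₁ (Kʸ _ _ _ _)) (proj₁ (Kʸ _ _ _ _)) (proj₁ (Kʸ _ _ _ _))) ,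
                          cong₂ _xor_ (G-edges (proj₂ (Kʸ _ _ _ _)) (proj₂ (Kʸ _ _ _ _)) (proj₂ (Kʸ _ _ _ _))) (G-edges (proj₂ (Kʸ _ _ _ _)) (proj₂ (Kʸ _ _ _ _)) (proj₂ (Kʸ _ _ _ _))))
             (λ x y _ _ → cong₂ _xor_ (G-edges (proj₁ (Kᶻ _ _ _ _)) (proj₁ (Kᶻ _ _ _ _)) (proj₁ (Kᶻ _ _ _ _))) (G-edges (proj₁ (Kᶻ _ _ _ _)) (proj₁ (Kᶻ _ _ _ _)) (proj₁ (Kᶻ _ _ _ _))) ,
                          cong₂ _xor_ (G-edges (proj₂ (Kᶻ _ _ _ _)) (proj₂ (Kᶻ _ _ _ _)) (proj₂ (Kᶻ _ _ _ _))) (G-edges (proj₂ (Kᶻ _ _ _ _)) (proj₂ (Kᶻ _ _ _ _)) (proj₂ (Kᶻ _ _ _ _)))) ⟩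
      (⨁ N λ y → ⨁ N λ z → X-square G N y z)
        ≡⟨ (⨁-false N λ y _ → ⨁-false N λ z _ →
             cong₂ _xor_ (G-const (a-right ri _ _) (a-right ri _ _) (a-right ri _ _)) (G-const (a-right ri _ _) (a-right ri _ _) (a-right ri _ _))) ⟩
      false ∎)
      where
      open ≡-Reasoning
      G : V → V → V → Bool
      G u v w = any H (u ∷ v ∷ w ∷ []) ∧ defect K u v w

      G-const : ∀ {u v w α} → a u ≡ α → a v ≡ α → a w ≡ α → G u v w ≡ false
      G-const {u} {v} {w} {α} p q r = ∧-falseʳ (any H (u ∷ v ∷ w ∷ [])) (defect-const {K} u v w α p q r)

      G-edges : ∀ {u v w} → K v w ≡ false → K u w ≡ false → K u v ≡ false → G u v w ≡ false
      G-edges {u} {v} {w} p q r = ∧-falseʳ (any H (u ∷ v ∷ w ∷ []))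
        (defect-scale {K} {u} {v} {w} true (inj₂ (cong₂ _xor_ p (cong₂ _xor_ q r))) (inj₂ p) (inj₂ q) (inj₂ r))

      -- A triangle with a vertex `m` of `A` outside `Y` meets `H` if and only if `l` does: by
      -- closedness `m` lies in `H` as soon as any vertex of the clique does. All other triangles
      -- have defect 0.
      face-weight : ∀ {l u v w} → Clique l → (∀ {x} → x ∈ (u ∷ v ∷ w ∷ []) → x ∈ l) →
                    any H l ∧ defect K u v w ≡ G u v w
      face-weight {l} {u} {v} {w} clique ⊆ with any (λ x → A x ∧ not (Y x)) (u ∷ v ∷ w ∷ []) in e
      ... | false = trans (∧-falseʳ (any H l) zero-defect) (sym (∧-falseʳ (any H (u ∷ v ∷ w ∷ [])) zero-defect))
        where
        A⊆Y : ∀ {x} → x ∈ (u ∷ v ∷ w ∷ []) → x ∈ᵇ A → x ∈ᵇ Y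
        A⊆Y {x} x∈ Ax with decide (Y x)
        ... | inj₁ Yx = Yx
        ... | inj₂ ¬Yx = true≢false (any-true {H = λ x → A x ∧ not (Y x)} x∈ (∧-intro Ax (cong not ¬Yx))) e
        zero-defect : defect K u v w ≡ false
        zero-defect = defect-flat u v w (λ x∈ y∈ → same (clique (⊆ x∈) (⊆ y∈)))
          (λ x∈ y∈ Bx By → K-flat (clique (⊆ x∈) (⊆ y∈)) Bx By (A⊆Y x∈) (A⊆Y y∈))
      ... | true with any-inv {H = λ x → A x ∧ not (Y x)} (u ∷ v ∷ w ∷ []) e
      ... | m , m∈ , e′ with ∧-inv e′ | decide (H m)
      ... | Am , ¬Ym | inj₁ Hm = cong (_∧ defect K u v w)
        (trans (any-true {H = H} (⊆ m∈) Hm) (sym (any-true {H = H} m∈ Hm)))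
      ... | Am , ¬Ym | inj₂ ¬Hm = cong (_∧ defect K u v w)
        (trans (any-false {H = H} l untouched) (sym (any-false {H = H} (u ∷ v ∷ w ∷ []) (λ x∈ → untouched (⊆ x∈)))))
        where
        untouched : ∀ {x} → x ∈ l → x ∈ᵇ H → ⊥
        untouched x∈ Hx with closed Hx Am (clique x∈ (⊆ m∈))
        ... | inj₁ Hm = true≢false Hm ¬Hm
        ... | inj₂ Ym = true≢false Ym (not-true ¬Ym)

      same-weight : ∀ u v w t → Clique (u ∷ v ∷ w ∷ t ∷ []) →
        weight H j k u v w t xor weight H j′ k′ u v w t ≡ δ₂ G u v w t
      same-weight u v w t clique = begin
        weight H j k u v w t xor weight H j′ k′ u v w t
          ≡⟨ Bool.∧-distribˡ-xor χ₄ (density (b j) (c k) u v w t) (density (b j′) (c k′) u v w t) ⟨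
        χ₄ ∧ (density (b j) (c k) u v w t xor density (b j′) (c k′) u v w t)
          ≡⟨ cong (χ₄ ∧_) (density-change {b j} {c k} {b j′} {c k′} {K} change u v w t) ⟩
        χ₄ ∧ δ₂ (defect K) u v w t
          ≡⟨ solve 5 (λ χ p q r s → χ :* (p :+ (q :+ (r :+ s))) := (χ :* p) :+ ((χ :* q) :+ ((χ :* r) :+ (χ :* s)))) refl
               χ₄ (defect K v w t) (defect K u w t) (defect K u v t) (defect K u v w) ⟩
        (χ₄ ∧ defect K v w t) xor ((χ₄ ∧ defect K u w t) xor ((χ₄ ∧ defect K u v t) xor (χ₄ ∧ defect K u v w)))
          ≡⟨ cong₂ _xor_ (face-weight clique there)
               (cong₂ _xor_ (face-weight clique (λ { (here e) → here e ; (there x∈) → there (there x∈) }))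
               (cong₂ _xor_ (face-weight clique (λ { (here e) → here e ; (there (here e)) → there (here e) ; (there (there x∈)) → there (there (there x∈)) }))
                            (face-weight clique (λ { (here e) → here e ; (there (here e)) → there (here e) ; (there (there (here e))) → there (there (here e)) })))) ⟩
        δ₂ G u v w t ∎
        where
        χ₄ = any H (u ∷ v ∷ w ∷ t ∷ [])

  -- The planes are moved one after the other. Each move changes the cup product by the coboundary
  -- of some `K` with a factor δc or δb that belongs to the plane at rest, and `flat` makes this
  -- factor vanish.
  degree-invariant : ∀ {Y H j k j′ k′} → Closed Y H → Avoids Y j k → Avoids Y j′ k′ →
    Range j → Range k → Range j′ → Range k′ → degree H j k ≡ degree H j′ k′
  degree-invariant {Y} {H} {j} {k} {j′} {k′} closed av av′ rj rk rj′ rk′ = trans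
    (degree-change closed (cup-change₁ (b j) (b j′) (c k))
      (λ {x} xy Bx By x∈ y∈ → ∧-falseʳ (b j x xor b j′ x) (≡-xor (proj₂ (flat av xy Bx By x∈ y∈))))
      (λ _ _ _ _ → cong (_∧ _) (≡-xor (trans (b-back rj _ _) (sym (b-back rj′ _ _)))) ,
                   cong (_∧ _) (≡-xor (trans (b-front rj _ _) (sym (b-front rj′ _ _)))))
      (λ _ _ _ _ → ∧-falseʳ _ (≡-xor (trans (c-top rk _ _) (sym (c-top rk _ _)))) ,
                   ∧-falseʳ _ (≡-xor (trans (c-bottom rk _ _) (sym (c-bottom rk _ _)))))
      rj)
    (degree-change closed (cup-change₂ (b j′) (c k) (c k′))
      (λ {x} {y} xy Bx By x∈ y∈ → cong (_∧ (c k y xor c k′ y)) (≡-xor (proj₁ (flat av′ xy Bx By x∈ y∈))))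
      (λ _ _ _ _ → cong (_∧ _) (≡-xor (trans (b-back rj′ _ _) (sym (b-back rj′ _ _)))) ,
                   cong (_∧ _) (≡-xor (trans (b-front rj′ _ _) (sym (b-front rj′ _ _)))))
      (λ _ _ _ _ → ∧-falseʳ _ (≡-xor (trans (c-top rk _ _) (sym (c-top rk′ _ _)))) ,
                   ∧-falseʳ _ (≡-xor (trans (c-bottom rk _ _) (sym (c-bottom rk′ _ _)))))
      rj)

-- Degrees of the pieces cut off by a tree decomposition

finite-¬¬ : ∀ {m} {P : Fin m → Set} → (∀ i → ¬ ¬ P i) → ¬ ¬ (∀ i → P i)
finite-¬¬ {zero}  ¬¬p k = k λ ()
finite-¬¬ {suc m} ¬¬p k = ¬¬p zero λ p₀ → finite-¬¬ (λ i → ¬¬p (suc i)) λ p₊ →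
  k λ { zero → p₀ ; (suc i) → p₊ i }

-- Adjacency in the tree of a decomposition comes without a decision procedure, but one may be
-- assumed while proving `⊥`.
¬¬-decidable : ∀ {m} (R : Fin m → Fin m → Set) → ¬ ¬ (∀ i j → Dec (R i j))
¬¬-decidable R = finite-¬¬ λ i → finite-¬¬ λ j → ¬¬-excluded-middle

_≟ᵛ_ : {n : ℕ} (u v : Vertex n) → Dec (u ≡ v)
_≟ᵛ_ = ×.≡-dec Fin._≟_ (×.≡-dec Fin._≟_ Fin._≟_)

abstract
  member : {n : ℕ} → List (Vertex n) → Vertex n → Bool
  member l v = does (any? (v ≟ᵛ_) l)

  member-intro : ∀ {n} {l : List (Vertex n)} {v} → v ∈ l → v ∈ᵇ member l
  member-intro = dec-true (any? _ _)

  member-inv : ∀ {n} {l : List (Vertex n)} {v} → v ∈ᵇ member l → v ∈ l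
  member-inv {l = l} {v} e with any? (v ≟ᵛ_) l
  ... | yes p = p

module Bags {n : ℕ} (A : Vertex n → Bool) (D : TreeDecomposition (induced (Q n) A)) where
  open TreeDecomposition D

  vertex-bag : Fin nodes → List (Vertex n)
  vertex-bag i = List.map proj₁ (bag i)

  Y : Fin nodes → Vertex n → Bool
  Y i = member (vertex-bag i)

  private
    lift : ∀ {v i} → v ∈ᵇ Y i → (p : T (A v)) → (v , p) ∈ bag i
    lift v∈ p with ∈-map⁻ proj₁ (member-inv v∈)
    ... | (v , q) , w∈ , refl = subst (λ r → (v , r) ∈ _) (Bool.T-irrelevant q p) w∈

    lower : ∀ {v i} {p : T (A v)} → (v , p) ∈ bag i → v ∈ᵇ Y i
    lower v∈ = member-intro (∈-map⁺ proj₁ v∈)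

  Y⊆A : ∀ {i v} → v ∈ᵇ Y i → v ∈ᵇ A
  Y⊆A v∈ with ∈-map⁻ proj₁ (member-inv v∈)
  ... | (v , p) , _ , refl = Equivalence.to Bool.T-≡ p

  cobag : ∀ {u v} → u ∈ᵇ A → v ∈ᵇ A → Touch u v → ∃ λ i → u ∈ᵇ Y i × v ∈ᵇ Y i
  cobag {u} {v} u∈ v∈ uv with u ≟ᵛ v
  ... | yes refl = let (i , w∈) = vertices (u , Equivalence.from Bool.T-≡ u∈) in i , lower w∈ , lower w∈
  ... | no u≢v = let (i , u∈′ , v∈′) = edges {u , Equivalence.from Bool.T-≡ u∈} {v , Equivalence.from Bool.T-≡ v∈} (u≢v , uv)
                 in i , lower u∈′ , lower v∈′

  conn : ∀ v → ConnectedOn tree (λ i → v ∈ᵇ Y i)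
  conn v i∋ j∋ = Star.map (λ (a , s , t) → a , lower {p = p} s , lower {p = p} t) (subtrees (v , p) (lift i∋ p) (lift j∋ p))
    where
    p : T (A v)
    p = Equivalence.from Bool.T-≡ (Y⊆A i∋)

  module _ (adj? : ∀ i j → Dec (Graph.Adj tree i j)) where
    open Elimination A Touch touch-refl touch-sym tree adj? isTree Y Y⊆A cobag conn public

module _ (d : ℕ) where

  -- The values that are not clear of `plane r` are those from r(2d) up to but excluding (r +
  -- 1)(2d), and these intervals are disjoint for distinct `r`.
  plane : ℕ → ℕ
  plane r = d + r * (d + d)

  Clear : ℕ → ℕ → Set
  Clear r y = d + y < plane r ⊎ d + plane r ≤ y

  clear? : ∀ r y → Dec (Clear r y)
  clear? r y = (d + y ℕ.<? plane r) ⊎-dec (d + plane r ℕ.≤? y)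

  clear-of-one : ∀ {r s} y → r < s → ¬ Clear r y → ¬ Clear s y → ⊥
  clear-of-one {r} {s} y r<s ¬r ¬s = ℕ.<-irrefl refl (begin-strict
    plane s                     ≤⟨ ℕ.≮⇒≥ (λ lt → ¬s (inj₁ lt)) ⟩
    d + y                       <⟨ ℕ.+-monoʳ-< d (ℕ.≰⇒> (λ le → ¬r (inj₂ le))) ⟩
    d + (d + plane r)           ≡⟨ ℕ.+-assoc d d _ ⟨
    (d + d) + (d + r * (d + d)) ≡⟨ ℕ.+-assoc (d + d) d _ ⟨
    (d + d) + d + r * (d + d)   ≡⟨ cong (_+ r * (d + d)) (ℕ.+-comm (d + d) d) ⟩
    d + (d + d) + r * (d + d)   ≡⟨ ℕ.+-assoc d (d + d) _ ⟩
    d + suc r * (d + d)         ≤⟨ ℕ.+-monoʳ-≤ d (ℕ.*-monoˡ-≤ (d + d) r<s) ⟩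
    plane s                     ∎)
    where open ℕ.≤-Reasoning

  -- Pigeonhole: each of at most `m` values blocks at most one of `m + 1` planes.
  clear-plane : ∀ (l : List ℕ) m → length l ≤ m → ∃ λ r → r ≤ m × (∀ {y} → y ∈ l → Clear r y)
  clear-plane l m len with Fin.any? (λ (r : Fin (suc m)) → all? (clear? (toℕ r)) l)
  ... | yes (r , clear) = toℕ r , ℕ.≤-pred (Fin.toℕ<n r) , All.lookup clear
  ... | no ¬clear =
    let (i , j , i<j , same) = Fin.pigeonhole (s≤s len) (λ r → Any.index (blocked r))
    in ⊥-elim (clear-of-one _ i<j (lookup-index (blocked i))
         (subst (λ k → ¬ Clear (toℕ j) (lookup l k)) (sym same) (lookup-index (blocked j))))
    where
    blocked : ∀ (r : Fin (suc m)) → Any.Any (λ y → ¬ Clear (toℕ r) y) l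
    blocked r = ¬All⇒Any¬ (clear? (toℕ r)) l (λ clear → ¬clear (r , clear))

-- The outermost plane needed to avoid two bags of `t` vertices each.
planes : ℕ → ℕ → ℕ
planes D t = plane (suc D) (t + t)

module Contradiction {N D t : ℕ} (N-large : D + planes D t ≤ N)
  (A χ : Vertex (suc N) → Bool) (rep : Vertex (suc N) → Vertex (suc N))
  (near : ∀ v → Near D v (rep v))
  (rep-const : ∀ {u v} → A u ≡ false → A v ≡ false → Touch u v → χ u ≡ χ v → rep u ≡ rep v)
  (𝒟 : TreeDecomposition (induced (Q (suc N)) A))
  (small : ∀ i → length (TreeDecomposition.bag 𝒟 i) ≤ t)
  where

  private
    V : Set
    V = Vertex (suc N)

  open Triangulation (pt {N}) N
  open Degree A χ rep near rep-const
  open Bags A 𝒟 hiding (Closed)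
  open TreeDecomposition 𝒟 using (tree; nodes; isTree)

  -- A simplex cannot meet both `H₁` and `H₂`. If it meets the merged set but neither of these, then
  -- by closedness all its vertices in `A` lie in the two bags, and its density is 0.
  degree-merge : ∀ {H₁ H₂ S₁ S₂ j k} → Avoids S₁ j k → Avoids S₂ j k →
    Closed S₁ (merge H₁ H₂ S₁ S₂) →
    (∀ {u v} → u ∈ᵇ H₁ → v ∈ᵇ H₂ ⊎ (v ∈ᵇ S₂ × S₁ v ≡ false) → ¬ Touch u v) →
    degree (merge H₁ H₂ S₁ S₂) j k ≡ degree H₁ j k xor degree H₂ j k
  degree-merge {H₁} {H₂} {S₁} {S₂} {j} {k} av₁ av₂ closed apart = trans
    (Σtet-cong {weight H′ j k} {λ u v w t → weight H₁ j k u v w t xor weight H₂ j k u v w t} (tet-cliques split))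
    (Σtet-xor (weight H₁ j k) (weight H₂ j k))
    where
    H′ : V → Bool
    H′ = merge H₁ H₂ S₁ S₂

    S : V → Bool
    S v = S₁ v ∨ S₂ v

    avoids : Avoids S j k
    avoids e with ∨-inv e
    ... | inj₁ s = av₁ s
    ... | inj₂ s = av₂ s

    cases : ∀ l {d} → Clique l →
      ((∀ {x} → x ∈ l → x ∈ᵇ A → x ∈ᵇ S) → d ≡ false) →
      any H′ l ∧ d ≡ (any H₁ l ∧ d) xor (any H₂ l ∧ d)
    cases l {d} clique zero-on-S with any H₁ l in e₁ | any H₂ l in e₂
    ... | true | true =
      let (u , u∈ , h₁) = any-inv {H = H₁} l e₁
          (v , v∈ , h₂) = any-inv {H = H₂} l e₂
      in ⊥-elim (apart h₁ (inj₁ h₂) (clique u∈ v∈))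
    ... | true | false =
      let (u , u∈ , h₁) = any-inv {H = H₁} l e₁
      in trans (cong (_∧ d) (any-true {H = H′} u∈ (∨-inl h₁))) (sym (Bool.xor-identityʳ d))
    ... | false | true =
      let (u , u∈ , h₂) = any-inv {H = H₂} l e₂
      in cong (_∧ d) (any-true {H = H′} u∈ (∨-inr {H₁ u} (∨-inl h₂)))
    ... | false | false with any H′ l in e
    ... | false = refl
    ... | true = let (m , m∈ , h) = any-inv {H = H′} l e in zero-on-S λ x∈ Ax → in-S x∈ (closed h Ax (clique m∈ x∈))
      where
      in-S : ∀ {x} → x ∈ l → x ∈ᵇ H′ ⊎ x ∈ᵇ S₁ → x ∈ᵇ S
      in-S x∈ (inj₂ s) = ∨-inl s
      in-S {x} x∈ (inj₁ h) with ∨-inv {H₁ x} h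
      ... | inj₁ h₁ = true≢false (any-true {H = H₁} x∈ h₁) e₁
      ... | inj₂ h′ with ∨-inv {H₂ x} h′
      ... | inj₁ h₂ = true≢false (any-true {H = H₂} x∈ h₂) e₂
      ... | inj₂ s = ∨-inr {S₁ x} (proj₁ (∧-inv s))

    split : ∀ u v w t → Clique (u ∷ v ∷ w ∷ t ∷ []) →
      weight H′ j k u v w t ≡ weight H₁ j k u v w t xor weight H₂ j k u v w t
    split u v w t clique = cases (u ∷ v ∷ w ∷ t ∷ []) {density (b j) (c k) u v w t} clique (density-avoiding {S} avoids u v w t clique)

  private
    coordinate-plane : (coord : V → ℕ) (l : List V) → length l ≤ t + t →
      ∃ λ j → Range j × (∀ {u} → u ∈ l → suc D + coord u < j ⊎ suc D + j ≤ coord u)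
    coordinate-plane coord l len with clear-plane (suc D) (List.map coord l) (t + t) (subst (_≤ t + t) (sym (List.length-map coord l)) len)
    ... | r , r≤ , far = plane (suc D) r ,
      (ℕ.m≤m+n (suc D) _ , ℕ.≤-trans (ℕ.+-monoʳ-≤ D (ℕ.+-monoʳ-≤ (suc D) (ℕ.*-monoˡ-≤ (suc D + suc D) r≤))) N-large) ,
      λ u∈ → far (∈-map⁺ coord u∈)

    avoid-bags : ∀ p q → ∃ λ j → ∃ λ k → Range j × Range k × Avoids (Y p) j k × Avoids (Y q) j k
    avoid-bags p q =
      let l = vertex-bag p ++ vertex-bag q
          len : length l ≤ t + t
          len = ℕ.≤-trans (ℕ.≤-reflexive (List.length-++ (vertex-bag p))) (ℕ.+-mono-≤ (bag-len p) (bag-len q))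
          (j , rj , fj) = coordinate-plane yc l len
          (k , rk , fk) = coordinate-plane zc l len
      in j , k , rj , rk ,
         (λ u∈ → fj (∈-++⁺ˡ (member-inv u∈)) , fk (∈-++⁺ˡ (member-inv u∈))) ,
         (λ u∈ → fj (∈-++⁺ʳ _ (member-inv u∈)) , fk (∈-++⁺ʳ _ (member-inv u∈)))
      where
      bag-len : ∀ i → length (vertex-bag i) ≤ t
      bag-len i = subst (_≤ t) (sym (List.length-map proj₁ (TreeDecomposition.bag 𝒟 i))) (small i)

    -- Each piece hanging from a bag of a tree decomposition has degree 0, while
    -- the whole cube has degree 1.
    Null : Fin nodes → (V → Bool) → Set
    Null i H = ∀ {j k} → Range j → Range k → Avoids (Y i) j k → degree H j k ≡ false

    null-empty : ∀ i → Null i (λ _ → false)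
    null-empty i {j} {k} _ _ _ = Σtet-false {weight (λ _ → false) j k} (tet-cliques λ _ _ _ _ _ → refl)

    absorb : ∀ x {d} → (x ≡ false → d ≡ false) → d ≡ x ∧ d
    absorb true  _ = refl
    absorb false z = z refl

    -- A simplex that misses `H` has all its vertices of `A` in the bag, and so contributes 0 to the
    -- total.
    degree-cover : ∀ {i H j k} → Avoids (Y i) j k → (∀ {v} → v ∈ᵇ A → v ∈ᵇ Y i ⊎ v ∈ᵇ H) →
      Σtet (density (b j) (c k)) ≡ degree H j k
    degree-cover {i} {H} {j} {k} av cover = Σtet-cong {density (b j) (c k)} {weight H j k} (tet-cliques touched)
      where
      in-bag : ∀ {x l} → any H l ≡ false → x ∈ l → x ∈ᵇ Y i ⊎ x ∈ᵇ H → x ∈ᵇ Y i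
      in-bag e x∈ (inj₁ y) = y
      in-bag e x∈ (inj₂ h) = true≢false (any-true {H = H} x∈ h) e
      touched : ∀ u v w t → Clique (u ∷ v ∷ w ∷ t ∷ []) → density (b j) (c k) u v w t ≡ weight H j k u v w t
      touched u v w t clique = absorb (any H l) {density (b j) (c k) u v w t} λ e →
        density-avoiding {Y i} {j} {k} av u v w t clique λ x∈ Ax → in-bag {l = l} e x∈ (cover Ax)
        where
        l : List V
        l = u ∷ v ∷ w ∷ t ∷ []

    nothing-left : ∀ i {H} → Null i H → (∀ {v} → v ∈ᵇ A → v ∈ᵇ Y i ⊎ v ∈ᵇ H) → ⊥
    nothing-left i {H} null cover = let (j , k , rj , rk , av , _) = avoid-bags i i in absurd (begin
      true                        ≡⟨ density-total rj rk ⟨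
      Σtet (density (b j) (c k))  ≡⟨ degree-cover {i} {H} {j} {k} av cover ⟩
      degree H j k                ≡⟨ null rj rk av ⟩
      false                       ∎)
      where
      open ≡-Reasoning
      absurd : true ≡ false → ⊥
      absurd ()

    -- The given planes avoid `Y p` but perhaps not `Y ℓ`. Invariance replaces them by planes that
    -- avoid both bags, for which the degree is additive.
    null-step : ∀ p ℓ {H₁ H₂} → Null p H₁ → Null ℓ H₂ →
      Closed (Y p) (merge H₁ H₂ (Y p) (Y ℓ)) →
      (∀ {u v} → u ∈ᵇ H₁ → v ∈ᵇ H₂ ⊎ (v ∈ᵇ Y ℓ × Y p v ≡ false) → ¬ Touch u v) →
      Null p (merge H₁ H₂ (Y p) (Y ℓ))
    null-step p ℓ {H₁} {H₂} null₁ null₂ closed apart {j} {k} rj rk av = let (j′ , k′ , rj′ , rk′ , avp , avℓ) = avoid-bags p ℓ in begin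
      degree (merge H₁ H₂ (Y p) (Y ℓ)) j k         ≡⟨ degree-invariant {Y p} {merge H₁ H₂ (Y p) (Y ℓ)} closed av avp rj rk rj′ rk′ ⟩
      degree (merge H₁ H₂ (Y p) (Y ℓ)) j′ k′       ≡⟨ degree-merge {H₁} {H₂} {Y p} {Y ℓ} avp avℓ closed apart ⟩
      degree H₁ j′ k′ xor degree H₂ j′ k′          ≡⟨ cong₂ _xor_ (null₁ rj′ rk′ avp) (null₂ rj′ rk′ avℓ) ⟩
      false                                        ∎
      where open ≡-Reasoning

  contradictory : ⊥
  contradictory = ¬¬-decidable (Graph.Adj tree) λ adj? →
    let (i , H , null , cover) = eliminate adj? Null null-empty
          (λ p ℓ {H₁} {H₂} null₁ null₂ _ _ _ _ closed apart {j} {k} → null-step p ℓ {H₁} {H₂} null₁ null₂ closed apart {j} {k})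
    in nothing-left i {H} null cover

-- Clustered colourings of graphs of bounded treewidth

univ : (n : ℕ) → List (Vertex n)
univ n = cartesianProduct (allFin n) (cartesianProduct (allFin n) (allFin n))

∈-univ : ∀ {n} (v : Vertex n) → v ∈ univ n
∈-univ (x , y , z) = ∈-cartesianProduct⁺ (∈-allFin x) (∈-cartesianProduct⁺ (∈-allFin y) (∈-allFin z))

univ-unique : ∀ n → Unique (univ n)
univ-unique n = cartesianProduct⁺ (allFin⁺ n) (cartesianProduct⁺ (allFin⁺ n) (allFin⁺ n))

module _ {V : Set} where

  select : (V → Bool) → List V → List V
  select P = filter (λ v → P v Bool.≟ true)

  private
    count-in : (V → Bool) → List V → ℕ
    count-in P xs = length (select P xs)

  count-in-cover : ∀ {P R S : V → Bool} xs → (∀ {v} → v ∈ᵇ P → v ∈ᵇ R ⊎ v ∈ᵇ S) →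
                   count-in P xs ≤ count-in R xs + count-in S xs
  count-in-cover [] ⊆ = z≤n
  count-in-cover {P} {R} {S} (x ∷ xs) ⊆ with count-in-cover {P} {R} {S} xs ⊆
  ... | ih with P x in p | R x in r | S x in s
  ... | false | true  | true  = ℕ.m≤n⇒m≤1+n (ℕ.≤-trans ih (ℕ.+-monoʳ-≤ (count-in R xs) (ℕ.n≤1+n _)))
  ... | false | true  | false = ℕ.m≤n⇒m≤1+n ih
  ... | false | false | true  = ℕ.≤-trans ih (ℕ.+-monoʳ-≤ (count-in R xs) (ℕ.n≤1+n _))
  ... | false | false | false = ih
  ... | true  | true  | true  = s≤s (ℕ.≤-trans ih (ℕ.+-monoʳ-≤ (count-in R xs) (ℕ.n≤1+n _)))
  ... | true  | true  | false = s≤s ih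
  ... | true  | false | true  = subst (suc (count-in P xs) ≤_) (sym (ℕ.+-suc (count-in R xs) _)) (s≤s ih)
  ... | true  | false | false with ⊆ {x} p
  ... | inj₁ r′ = true≢false r′ r
  ... | inj₂ s′ = true≢false s′ s

  count-in-disjoint : ∀ {P R S : V → Bool} xs → (∀ {v} → v ∈ᵇ R → v ∈ᵇ P × S v ≡ false) → (∀ {v} → v ∈ᵇ S → v ∈ᵇ P) →
                      count-in R xs + count-in S xs ≤ count-in P xs
  count-in-disjoint [] _ _ = z≤n
  count-in-disjoint {P} {R} {S} (x ∷ xs) r⊆ s⊆ with count-in-disjoint {P} {R} {S} xs r⊆ s⊆
  ... | ih with R x in r | S x in s | P x in p
  ... | false | false | false = ih
  ... | false | false | true  = ℕ.m≤n⇒m≤1+n ih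
  ... | false | true  | true  = subst (_≤ suc (count-in P xs)) (sym (ℕ.+-suc (count-in R xs) _)) (s≤s ih)
  ... | false | true  | false = true≢false (s⊆ {x} s) p
  ... | true  | false | true  = s≤s ih
  ... | true  | false | false = true≢false (proj₁ (r⊆ {x} r)) p
  ... | true  | true  | _     = true≢false s (proj₂ (r⊆ {x} r))

  count-in-single : ∀ {P : V → Bool} {x} xs → Unique xs → (∀ {v} → v ∈ᵇ P → v ≡ x) → count-in P xs ≤ 1
  count-in-single [] _ _ = z≤n
  count-in-single {P} {x} (y ∷ xs) (y∉ ∷ u) only with P y in p
  ... | false = count-in-single xs u only
  ... | true  = s≤s (ℕ.≤-reflexive (cong length
    (List.filter-none (λ v → P v Bool.≟ true) (All.map (λ y≢v Pv → y≢v (trans (only p) (sym (only Pv)))) y∉))))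

module _ {n : ℕ} where

  elements : (Vertex n → Bool) → List (Vertex n)
  elements P = select P (univ n)

  ∈-elements : ∀ {P v} → v ∈ᵇ P → v ∈ elements P
  ∈-elements {P} {v} = ∈-filter⁺ (λ v → P v Bool.≟ true) (∈-univ v)

  abstract
    count : (Vertex n → Bool) → ℕ
    count P = length (elements P)

    count-elements : ∀ P → length (elements P) ≡ count P
    count-elements P = refl

    count-cover : ∀ {P R S} → (∀ {v} → v ∈ᵇ P → v ∈ᵇ R ⊎ v ∈ᵇ S) → count P ≤ count R + count S
    count-cover {P} {R} {S} = count-in-cover {P = P} {R} {S} (univ n)

    count-disjoint : ∀ {P R S} → (∀ {v} → v ∈ᵇ R → v ∈ᵇ P × S v ≡ false) → (∀ {v} → v ∈ᵇ S → v ∈ᵇ P) →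
                     count R + count S ≤ count P
    count-disjoint {P} {R} {S} = count-in-disjoint {P = P} {R} {S} (univ n)

    count-empty : ∀ {P} → (∀ {v} → v ∈ᵇ P → ⊥) → count P ≡ 0
    count-empty {P} ¬p = cong length (List.filter-none (λ v → P v Bool.≟ true) (All.universal (λ _ p → ¬p p) (univ n)))

    count-single : ∀ {P x} → (∀ {v} → v ∈ᵇ P → v ≡ x) → count P ≤ 1
    count-single only = count-in-single (univ n) (univ-unique n) only

    count-pos : ∀ {P v} → v ∈ᵇ P → 1 ≤ count P
    count-pos {P} v∈ with elements P | ∈-elements {P} v∈
    ... | _ ∷ _ | _ = s≤s z≤n

  count-mono : ∀ {P R} → (∀ {v} → v ∈ᵇ P → v ∈ᵇ R) → count P ≤ count R
  count-mono {P} {R} ⊆ = ℕ.≤-trans (count-cover {P} {R} {λ _ → false} (λ p → inj₁ (⊆ p)))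
    (ℕ.≤-reflexive (trans (cong (count R +_) (count-empty (λ ()))) (ℕ.+-identityʳ _)))

  count-< : ∀ {P R v} → (∀ {v} → v ∈ᵇ P → v ∈ᵇ R) → v ∈ᵇ R → P v ≡ false → count P < count R
  count-< {P} {R} {v} ⊆ Rv ¬Pv = ℕ.≤-trans
    (ℕ.≤-trans (ℕ.≤-reflexive (ℕ.+-comm 1 (count P))) (ℕ.+-monoʳ-≤ (count P) (count-pos {S} {v} (member-intro (here refl)))))
    (count-disjoint {R} {P} {S}
      (λ {u} p → ⊆ p , Bool.¬-not (λ s → case (member-inv s) of λ { (here refl) → true≢false p ¬Pv }))
      (λ s → case (member-inv s) of λ { (here refl) → Rv }))
    where
    S : Vertex n → Bool
    S = member (v ∷ [])

  count-member : ∀ l → count (member l) ≤ length l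
  count-member [] = ℕ.≤-reflexive (count-empty (λ m → case (member-inv m) of λ ()))
  count-member (x ∷ l) = ℕ.≤-trans
    (count-cover {member (x ∷ l)} {member (x ∷ [])} {member l}
      (λ m → case (member-inv m) of λ { (here e) → inj₁ (member-intro (here e)) ; (there m′) → inj₂ (member-intro m′) }))
    (ℕ.+-mono-≤ (count-single {x = x} (λ s → case (member-inv s) of λ { (here e) → e })) (count-member l))

module Separation {n t : ℕ} (A : Vertex n → Bool) (𝒟 : TreeDecomposition (induced (Q n) A))
  (small : ∀ i → length (TreeDecomposition.bag 𝒟 i) ≤ t)
  (adj? : ∀ i j → Dec (Graph.Adj (TreeDecomposition.tree 𝒟) i j)) where

  open Bags A 𝒟
  open TreeDecomposition 𝒟 using (nodes; bag)

  bag-count : ∀ i → count (Y i) ≤ t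
  bag-count i = ℕ.≤-trans (count-member (vertex-bag i))
    (subst (_≤ t) (sym (List.length-map proj₁ (bag i))) (small i))

  -- If `W` has more than 4t vertices, both sides stay smaller than `W` after the bag is added to
  -- them: this side has at most 3t vertices and the bag at most `t`, while the other side loses
  -- more than the `t` that it may gain.
  record Separator (W : Vertex n → Bool) : Set where
    field
      node   : Fin nodes
      side   : Vertex n → Bool
      closed : Closed adj? (Y node) side
      large  : t < count (λ v → W v ∧ side v)
      small′ : count (λ v → W v ∧ side v) ≤ t + (t + t)

  -- The first merged piece with more than `t` vertices of `W` is taken. It comes from two smaller
  -- pieces and part of a bag, each with at most `t` of them. If there were none, the last bag and
  -- its piece would cover `W` by at most 2t vertices.
  separate : ∀ W → (∀ {v} → v ∈ᵇ W → v ∈ᵇ A) → t + t < count W → Separator W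
  separate W W⊆A W-large =
    finish (eliminate adj? Φ (λ _ → inj₁ (ℕ.≤-trans (ℕ.≤-reflexive (count-empty (λ {v} e → true≢false (proj₂ (∧-inv {W v} e)) refl))) z≤n)) step)
    where
    part : (Vertex n → Bool) → ℕ
    part H = count (λ v → W v ∧ H v)

    Φ : Fin nodes → (Vertex n → Bool) → Set
    Φ i H = part H ≤ t ⊎ Separator W

    merge-part : ∀ p ℓ H₁ H₂ → part (merge H₁ H₂ (Y p) (Y ℓ)) ≤ part H₁ + (part H₂ + count (Y ℓ))
    merge-part p ℓ H₁ H₂ = ℕ.≤-trans
      (count-cover {S = λ v → (W v ∧ H₂ v) ∨ Y ℓ v} (λ {v} e → left {v} (∧-inv e)))
      (ℕ.+-monoʳ-≤ (part H₁) (count-cover ∨-inv))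
      where
      left : ∀ {v} → v ∈ᵇ W × v ∈ᵇ merge H₁ H₂ (Y p) (Y ℓ) → W v ∧ H₁ v ≡ true ⊎ (W v ∧ H₂ v) ∨ Y ℓ v ≡ true
      left {v} (w , m) with ∨-inv {H₁ v} m
      ... | inj₁ h = inj₁ (∧-intro w h)
      ... | inj₂ m′ with ∨-inv {H₂ v} m′
      ... | inj₁ h = inj₂ (∨-inl (∧-intro w h))
      ... | inj₂ y = inj₂ (∨-inr {W v ∧ H₂ v} (proj₁ (∧-inv y)))

    step : ∀ p ℓ {H₁ H₂} → Φ p H₁ → Φ ℓ H₂ → _ → _ → _ → _ → Closed adj? (Y p) (merge H₁ H₂ (Y p) (Y ℓ)) → _ →
           Φ p (merge H₁ H₂ (Y p) (Y ℓ))
    step p ℓ (inj₂ s) _ _ _ _ _ _ _ = inj₂ s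
    step p ℓ (inj₁ _) (inj₂ s) _ _ _ _ _ _ = inj₂ s
    step p ℓ {H₁} {H₂} (inj₁ le₁) (inj₁ le₂) _ _ _ _ closed _ with part (merge H₁ H₂ (Y p) (Y ℓ)) ℕ.≤? t
    ... | yes le = inj₁ le
    ... | no gt  = inj₂ record
      { node = p ; side = merge H₁ H₂ (Y p) (Y ℓ) ; closed = closed ; large = ℕ.≰⇒> gt
      ; small′ = ℕ.≤-trans (merge-part p ℓ H₁ H₂) (ℕ.+-mono-≤ le₁ (ℕ.+-mono-≤ le₂ (bag-count ℓ))) }

    finish : (∃ λ i → ∃ λ H → Φ i H × (∀ {v} → v ∈ᵇ A → v ∈ᵇ Y i ⊎ v ∈ᵇ H)) → Separator W
    finish (i , H , inj₂ s , _) = s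
    finish (i , H , inj₁ le , cover) = contradiction
      (ℕ.≤-trans (count-cover {P = W} {Y i} {λ v → W v ∧ H v} (λ w → ⊎.map₂ (∧-intro w) (cover (W⊆A w))))
        (ℕ.+-mono-≤ (bag-count i) le))
      (ℕ.<⇒≱ W-large)

around : {N : ℕ} → Fin (suc N) → List (Fin (suc N))
around i = clamp (toℕ i ∸ 1) ∷ clamp (toℕ i) ∷ clamp (suc (toℕ i)) ∷ []

clamp-toℕ : ∀ {N} (k : Fin (suc N)) → clamp (toℕ k) ≡ k
clamp-toℕ k = Fin.toℕ-injective (toℕ-clamp (ℕ.≤-pred (Fin.toℕ<n k)))

∈-around : ∀ {N} {i j : Fin (suc N)} → Close 1 (toℕ i) (toℕ j) → j ∈ around i
∈-around {i = i} {j} (i≤ , j≤) with ℕ.m≤n⇒m<n∨m≡n j≤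
... | inj₂ e = there (there (here (trans (sym (clamp-toℕ j)) (cong clamp e))))
... | inj₁ (s≤s j≤i) with ℕ.m≤n⇒m<n∨m≡n i≤
... | inj₂ e = here (trans (sym (clamp-toℕ j)) (cong (λ m → clamp (m ∸ 1)) (sym e)))
... | inj₁ (s≤s i≤j) = there (here (trans (sym (clamp-toℕ j)) (cong clamp (ℕ.≤-antisym j≤i i≤j))))

-- Repetitions at the border, where `clamp` truncates, are kept, so that each vertex has exactly 27
-- entries.
neighbours : {N : ℕ} → List (Vertex (suc N)) → List (Vertex (suc N))
neighbours [] = []
neighbours ((x , y , z) ∷ l) = cartesianProduct (around x) (cartesianProduct (around y) (around z)) ++ neighbours l

∈-neighbours : ∀ {N} {l : List (Vertex (suc N))} {u v} → u ∈ l → Touch u v → v ∈ neighbours l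
∈-neighbours {u = u} {v} (here refl) uv = let (x , y , z) = touch-close {u = u} {v} uv in
  ∈-++⁺ˡ (∈-cartesianProduct⁺ (∈-around x) (∈-cartesianProduct⁺ (∈-around y) (∈-around z)))
∈-neighbours {l = (x , y , z) ∷ _} (there u∈) uv =
  ∈-++⁺ʳ (cartesianProduct (around x) (cartesianProduct (around y) (around z))) (∈-neighbours u∈ uv)

length-neighbours : ∀ {N} (l : List (Vertex (suc N))) → length (neighbours l) ≡ length l * 27
length-neighbours [] = refl
length-neighbours (v ∷ l) = cong (27 +_) (length-neighbours l)

close-trans : ∀ {d e m n o} → Close d m n → Close e n o → Close (d + e) m o
close-trans {d} {e} {m} {n} {o} (m≤ , n≤) (n≤′ , o≤) =
  ℕ.≤-trans m≤ (ℕ.≤-trans (ℕ.+-monoʳ-≤ d n≤′) (ℕ.≤-reflexive (sym (ℕ.+-assoc d e o)))) ,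
  ℕ.≤-trans o≤ (ℕ.≤-trans (ℕ.+-monoʳ-≤ e n≤) (ℕ.≤-reflexive (trans (sym (ℕ.+-assoc e d m)) (cong (_+ m) (ℕ.+-comm e d)))))

-- 2^m - 1. The recursion is the cost of one new vertex in `representatives`: from a vertex to its
-- old representative, on to a vertex of that class which touches the new one, and one more step.
spread : ℕ → ℕ
spread zero    = 0
spread (suc m) = suc (spread m + spread m)

spread-mono : ∀ {m o} → m ≤ o → spread m ≤ spread o
spread-mono z≤n = z≤n
spread-mono (s≤s le) = s≤s (ℕ.+-mono-≤ (spread-mono le) (spread-mono le))

module _ {n : ℕ} where

  near-refl : ∀ {d} {v : Vertex n} → Near d v v
  near-refl {d} = (ℕ.m≤n+m _ d , ℕ.m≤n+m _ d) , (ℕ.m≤n+m _ d , ℕ.m≤n+m _ d) , (ℕ.m≤n+m _ d , ℕ.m≤n+m _ d)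

  near-sym : ∀ {d} {u v : Vertex n} → Near d u v → Near d v u
  near-sym (x , y , z) = ×.swap x , ×.swap y , ×.swap z

  near-trans : ∀ {d e} {u v w : Vertex n} → Near d u v → Near e v w → Near (d + e) u w
  near-trans (x , y , z) (x′ , y′ , z′) = close-trans x x′ , close-trans y y′ , close-trans z z′

  near-mono : ∀ {d e} {u v : Vertex n} → d ≤ e → Near d u v → Near e u v
  near-mono {d} {e} d≤e (x , y , z) = close-mono x , close-mono y , close-mono z
    where
    close-mono : ∀ {m n} → Close d m n → Close e m n
    close-mono (p , q) = ℕ.≤-trans p (ℕ.+-monoˡ-≤ _ d≤e) , ℕ.≤-trans q (ℕ.+-monoˡ-≤ _ d≤e)

  touch? : (u v : Vertex n) → Dec (Touch u v)
  touch? u v = (u ⊑? v) ⊎-dec (v ⊑? u)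
    where
    _≲?_ : (i j : Fin n) → Dec (i ≲ j)
    i ≲? j = (toℕ i ℕ.≤? toℕ j) ×-dec (toℕ j ℕ.≤? suc (toℕ i))
    _⊑?_ : (u v : Vertex n) → Dec (u ⊑ v)
    (x , y , z) ⊑? (x′ , y′ , z′) = (x ≲? x′) ×-dec ((y ≲? y′) ×-dec (z ≲? z′))

  -- As in union-find, the new vertex `x` becomes the representative of all classes with a member
  -- that touches it.
  representatives : (l : List (Vertex n)) → ∃ λ (rep : Vertex n → Vertex n) →
    (∀ {u v} → u ∈ l → v ∈ l → Touch u v → rep u ≡ rep v) × (∀ v → Near (spread (length l)) v (rep v))
  representatives [] = (λ v → v) , (λ ()) , (λ v → near-refl)
  representatives (x ∷ l) with representatives l
  ... | rep , same , near = rep′ , same′ , near′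
    where
    Joins : Vertex n → Vertex n → Set
    Joins u w = Touch x w × rep w ≡ rep u

    joins? : ∀ u w → Dec (Joins u w)
    joins? u w = touch? x w ×-dec (rep w ≟ᵛ rep u)

    rep′ : Vertex n → Vertex n
    rep′ u with u ≟ᵛ x | any? (joins? u) l
    ... | yes _ | _     = x
    ... | no _  | yes _ = x
    ... | no _  | no _  = rep u

    at-x : ∀ {u} → u ≡ x → rep′ u ≡ x
    at-x {u} e with u ≟ᵛ x
    ... | yes _ = refl
    ... | no ne = contradiction e ne

    joined : ∀ {u} → u ∈ l → Touch x u → rep′ u ≡ x
    joined {u} u∈ xu with u ≟ᵛ x | any? (joins? u) l
    ... | yes _ | _     = refl
    ... | no _  | yes _ = refl
    ... | no _  | no ¬j = contradiction (lose u∈ (xu , refl)) ¬j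

    both : ∀ {u v} → u ∈ l → v ∈ l → Touch u v → u ≢ x → v ≢ x → rep′ u ≡ rep′ v
    both {u} {v} u∈ v∈ uv u≢ v≢ with u ≟ᵛ x | any? (joins? u) l | v ≟ᵛ x | any? (joins? v) l
    ... | yes e | _     | _     | _     = contradiction e u≢
    ... | no _  | _     | yes e | _     = contradiction e v≢
    ... | no _  | yes _ | no _  | yes _ = refl
    ... | no _  | no _  | no _  | no _  = same u∈ v∈ uv
    ... | no _  | yes j | no _  | no ¬j = contradiction (Any.map (λ (t , e) → t , trans e (same u∈ v∈ uv)) j) ¬j
    ... | no _  | no ¬j | no _  | yes j = contradiction (Any.map (λ (t , e) → t , trans e (sym (same u∈ v∈ uv))) j) ¬j

    same′ : ∀ {u v} → u ∈ x ∷ l → v ∈ x ∷ l → Touch u v → rep′ u ≡ rep′ v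
    same′ (here refl) (here refl) _ = refl
    same′ (here refl) (there v∈) uv = trans (at-x refl) (sym (joined v∈ uv))
    same′ (there u∈) (here refl) uv = trans (joined u∈ (touch-sym uv)) (sym (at-x refl))
    same′ {u} {v} (there u∈) (there v∈) uv = by-cases (u ≟ᵛ x) (v ≟ᵛ x)
      where
      by-cases : Dec (u ≡ x) → Dec (v ≡ x) → rep′ u ≡ rep′ v
      by-cases (yes refl) _          = trans (at-x refl) (sym (joined v∈ uv))
      by-cases (no _)     (yes refl) = trans (joined u∈ (touch-sym uv)) (sym (at-x refl))
      by-cases (no p)     (no q)     = both u∈ v∈ uv p q

    s : ℕ
    s = spread (length l)

    near′ : ∀ u → Near (suc (s + s)) u (rep′ u)
    near′ u with u ≟ᵛ x | any? (joins? u) l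
    ... | yes refl | _   = near-refl
    ... | no _  | no _   = near-mono (ℕ.m≤n⇒m≤1+n (ℕ.m≤m+n s s)) (near u)
    ... | no _  | yes j with find j
    ... | w , _ , xw , e = near-mono (ℕ.≤-reflexive (trans (cong (s +_) (ℕ.+-comm s 1)) (ℕ.+-suc s s)))
      (near-trans {s} (near u) (near-trans {s} {1} (subst (λ r → Near s r w) e (near-sym (near w))) (touch-close (touch-sym xw))))

  -- That monochromatic components have bounded diameter is expressed by representatives within
  -- distance `D`, which avoids speaking of paths.
  record Coloured (G : Vertex n → Bool) (D : ℕ) : Set where
    field
      colour    : Vertex n → Bool
      rep       : Vertex n → Vertex n
      rep-near  : ∀ v → Near D v (rep v)
      rep-const : ∀ {u v} → u ∈ᵇ G → v ∈ᵇ G → Touch u v → colour u ≡ colour v → rep u ≡ rep v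

  -- The vertices of root have colour κ and form a union of monochromatic
  -- components; they still lack representatives.
  record Rooted (G W : Vertex n → Bool) (κ : Bool) (r D : ℕ) : Set where
    field
      colour      : Vertex n → Bool
      rep         : Vertex n → Vertex n
      rep-near    : ∀ v → Near D v (rep v)
      root        : Vertex n → Bool
      root⊆       : ∀ {v} → v ∈ᵇ root → v ∈ᵇ G
      ⊆root       : ∀ {v} → v ∈ᵇ W → v ∈ᵇ G → v ∈ᵇ root
      root-colour : ∀ {v} → v ∈ᵇ root → colour v ≡ κ
      root-size   : count root ≤ r
      root-closed : ∀ {u v} → u ∈ᵇ root → v ∈ᵇ G → Touch u v → colour v ≡ κ → v ∈ᵇ root
      rep-const   : ∀ {u v} → u ∈ᵇ G → v ∈ᵇ G → root u ≡ false → root v ≡ false →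
                    Touch u v → colour u ≡ colour v → rep u ≡ rep v

  -- Only the vertices of `root` lack representatives. They are few, so `spread` bounds the
  -- distances, and `root-closed` forbids edges from them to other vertices of the same colour.
  coloured : ∀ {G W κ r D} → spread r ≤ D → (𝓡 : Rooted G W κ r D) →
             Σ (Coloured G D) λ 𝓒 → Coloured.colour 𝓒 ≡ Rooted.colour 𝓡
  coloured {G} {κ = κ} {r} {D} le 𝓡 = record
    { colour = colour ; rep = rep′ ; rep-near = near′ ; rep-const = const′ } , refl
    where
    open Rooted 𝓡
    R = representatives (elements root)

    rep′ : Vertex n → Vertex n
    rep′ v = if root v then proj₁ R v else rep v

    near′ : ∀ v → Near D v (rep′ v)
    near′ v with root v
    ... | false = rep-near v
    ... | true  = near-mono (ℕ.≤-trans (spread-mono (ℕ.≤-trans (ℕ.≤-reflexive (count-elements root)) root-size)) le) (proj₂ (proj₂ R) v)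

    const′ : ∀ {u v} → u ∈ᵇ G → v ∈ᵇ G → Touch u v → colour u ≡ colour v → rep′ u ≡ rep′ v
    const′ {u} {v} u∈ v∈ uv e with root u in ru | root v in rv
    ... | true  | true  = proj₁ (proj₂ R) (∈-elements ru) (∈-elements rv) uv
    ... | false | false = rep-const u∈ v∈ ru rv uv e
    ... | true  | false = true≢false (root-closed ru v∈ uv (trans (sym e) (root-colour ru))) rv
    ... | false | true  = true≢false (root-closed rv u∈ (touch-sym uv) (trans e (root-colour rv))) ru

∧-inl : ∀ {x y} → x ∧ y ≡ true → x ≡ true
∧-inl e = proj₁ (∧-inv e)

-- The two colourings agree on the part of `S` in `G`, which lies in both roots and thus has colour
-- `κ`. An edge of `G` from one side to the other has an end in `S`, so monochromatic components
-- outside the roots stay on one side.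
rooted-split : ∀ {n r D} {A H S G W : Vertex n → Bool} {κ} →
  (∀ {v} → v ∈ᵇ G → v ∈ᵇ A) →
  (∀ {u v} → u ∈ᵇ H → v ∈ᵇ A → Touch u v → v ∈ᵇ H ⊎ v ∈ᵇ S) →
  Rooted (λ v → G v ∧ (H v ∨ S v)) (λ v → (W v ∧ H v) ∨ S v) κ r D →
  Rooted (λ v → G v ∧ (not (H v) ∨ S v)) (λ v → (W v ∧ not (H v)) ∨ S v) κ r D →
  Rooted G W κ (r + r) D
rooted-split {n} {r} {D} {A} {H} {S} {G} {W} {κ} G⊆A closed 𝓡₁ 𝓡₂ = record
  { colour      = colour
  ; rep         = rep
  ; rep-near    = rep-near
  ; root        = root
  ; root⊆       = λ e → [ (λ r₁ → ∧-inl (𝓡₁.root⊆ r₁)) , (λ r₂ → ∧-inl (𝓡₂.root⊆ r₂)) ]′ (∨-inv e)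
  ; ⊆root       = ⊆root
  ; root-colour = λ e → [ colour-root₁ , colour-root₂ ]′ (∨-inv e)
  ; root-size   = ℕ.≤-trans (count-cover {P = root} {𝓡₁.root} {𝓡₂.root} ∨-inv) (ℕ.+-mono-≤ 𝓡₁.root-size 𝓡₂.root-size)
  ; root-closed = root-closed
  ; rep-const   = rep-const
  }
  where
  module 𝓡₁ = Rooted 𝓡₁
  module 𝓡₂ = Rooted 𝓡₂
  G₁ G₂ root : Vertex n → Bool
  G₁ v = G v ∧ (H v ∨ S v)
  G₂ v = G v ∧ (not (H v) ∨ S v)
  root v = 𝓡₁.root v ∨ 𝓡₂.root v

  colour : Vertex n → Bool
  colour v = if G₁ v then 𝓡₁.colour v else 𝓡₂.colour v

  rep : Vertex n → Vertex n
  rep v = if G₁ v then 𝓡₁.rep v else 𝓡₂.rep v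

  rep-near : ∀ v → Near D v (rep v)
  rep-near v with G₁ v
  ... | true  = 𝓡₁.rep-near v
  ... | false = 𝓡₂.rep-near v

  colour₁ : ∀ {v} → v ∈ᵇ G₁ → colour v ≡ 𝓡₁.colour v
  colour₁ e rewrite e = refl

  colour₂ : ∀ {v} → G₁ v ≡ false → colour v ≡ 𝓡₂.colour v
  colour₂ e rewrite e = refl

  in-H : ∀ {v} → v ∈ᵇ G → v ∈ᵇ H → v ∈ᵇ G₁
  in-H g h = ∧-intro g (∨-inl h)

  in-S₁ : ∀ {v} → v ∈ᵇ G → v ∈ᵇ S → v ∈ᵇ G₁
  in-S₁ {v} g s = ∧-intro g (∨-inr {H v} s)

  in-S₂ : ∀ {v} → v ∈ᵇ G → v ∈ᵇ S → v ∈ᵇ G₂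
  in-S₂ {v} g s = ∧-intro g (∨-inr {not (H v)} s)

  S-root₁ : ∀ {v} → v ∈ᵇ G → v ∈ᵇ S → v ∈ᵇ 𝓡₁.root
  S-root₁ {v} g s = 𝓡₁.⊆root (∨-inr {W v ∧ H v} s) (in-S₁ g s)

  S-root₂ : ∀ {v} → v ∈ᵇ G → v ∈ᵇ S → v ∈ᵇ 𝓡₂.root
  S-root₂ {v} g s = 𝓡₂.⊆root (∨-inr {W v ∧ not (H v)} s) (in-S₂ g s)

  G₁-inv : ∀ {v} → v ∈ᵇ G₁ → v ∈ᵇ H ⊎ v ∈ᵇ S
  G₁-inv e = ∨-inv (proj₂ (∧-inv e))

  outside : ∀ {v} → v ∈ᵇ G → G₁ v ≡ false → H v ≡ false × v ∈ᵇ G₂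
  outside {v} g ¬g₁ with decide (H v)
  ... | inj₁ h  = true≢false (in-H g h) ¬g₁
  ... | inj₂ ¬h = ¬h , ∧-intro g (∨-inl (cong not ¬h))

  crossing : ∀ {u v} → u ∈ᵇ G₁ → v ∈ᵇ G → G₁ v ≡ false → Touch u v → u ∈ᵇ S
  crossing g₁ gv ¬g₁ uv with G₁-inv g₁
  ... | inj₂ s = s
  ... | inj₁ h with closed h (G⊆A gv) uv
  ... | inj₁ h′ = true≢false (in-H gv h′) ¬g₁
  ... | inj₂ s′ = true≢false (in-S₁ gv s′) ¬g₁

  ⊆root : ∀ {v} → v ∈ᵇ W → v ∈ᵇ G → v ∈ᵇ root
  ⊆root {v} w g with decide (H v)
  ... | inj₁ h  = ∨-inl (𝓡₁.⊆root (∨-inl (∧-intro w h)) (in-H g h))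
  ... | inj₂ ¬h = ∨-inr {𝓡₁.root v} (𝓡₂.⊆root (∨-inl (∧-intro w (cong not ¬h))) (∧-intro g (∨-inl (cong not ¬h))))

  colour-root₁ : ∀ {v} → v ∈ᵇ 𝓡₁.root → colour v ≡ κ
  colour-root₁ e = trans (colour₁ (𝓡₁.root⊆ e)) (𝓡₁.root-colour e)

  G₂-inv : ∀ {v} → v ∈ᵇ G₂ → H v ≡ false ⊎ v ∈ᵇ S
  G₂-inv e = ⊎.map₁ not-true (∨-inv (proj₂ (∧-inv e)))

  both : ∀ {v} → v ∈ᵇ G₁ → v ∈ᵇ G₂ → v ∈ᵇ S
  both g₁ g₂ with G₁-inv g₁ | G₂-inv g₂
  ... | inj₂ s | _       = s
  ... | inj₁ _ | inj₂ s  = s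
  ... | inj₁ h | inj₁ ¬h = true≢false h ¬h

  colour-root₂ : ∀ {v} → v ∈ᵇ 𝓡₂.root → colour v ≡ κ
  colour-root₂ {v} e with decide (G₁ v)
  ... | inj₁ g₁  = colour-root₁ (S-root₁ (∧-inl g₁) (both g₁ (𝓡₂.root⊆ e)))
  ... | inj₂ ¬g₁ = trans (colour₂ ¬g₁) (𝓡₂.root-colour e)

  closed₁ : ∀ {u v} → u ∈ᵇ 𝓡₁.root → v ∈ᵇ G₁ → Touch u v → colour v ≡ κ → v ∈ᵇ root
  closed₁ r g₁ uv e = ∨-inl (𝓡₁.root-closed r g₁ uv (trans (sym (colour₁ g₁)) e))

  closed₂ : ∀ {u v} → u ∈ᵇ 𝓡₂.root → v ∈ᵇ G → G₁ v ≡ false → Touch u v → colour v ≡ κ → v ∈ᵇ root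
  closed₂ {v = v} r g ¬g₁ uv e = ∨-inr {𝓡₁.root v}
    (𝓡₂.root-closed r (proj₂ (outside g ¬g₁)) uv (trans (sym (colour₂ ¬g₁)) e))

  root-closed : ∀ {u v} → u ∈ᵇ root → v ∈ᵇ G → Touch u v → colour v ≡ κ → v ∈ᵇ root
  root-closed {u} {v} r g uv e with ∨-inv r | decide (G₁ v)
  ... | inj₁ r₁ | inj₁ g₁  = closed₁ r₁ g₁ uv e
  ... | inj₁ r₁ | inj₂ ¬g₁ =
    let gu = 𝓡₁.root⊆ r₁ in closed₂ (S-root₂ (∧-inl gu) (crossing gu g ¬g₁ uv)) g ¬g₁ uv e
  ... | inj₂ r₂ | inj₂ ¬g₁ = closed₂ r₂ g ¬g₁ uv e
  ... | inj₂ r₂ | inj₁ g₁ with G₁-inv g₁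
  ... | inj₂ s = ∨-inl (S-root₁ g s)
  ... | inj₁ h with G₂-inv (𝓡₂.root⊆ r₂)
  ... | inj₂ s = closed₁ (S-root₁ (∧-inl (𝓡₂.root⊆ r₂)) s) g₁ uv e
  ... | inj₁ ¬h with closed h (G⊆A (∧-inl (𝓡₂.root⊆ r₂))) (touch-sym uv)
  ... | inj₁ h′ = true≢false h′ ¬h
  ... | inj₂ s = closed₁ (S-root₁ (∧-inl (𝓡₂.root⊆ r₂)) s) g₁ uv e

  outside-root : ∀ {v} → root v ≡ false → 𝓡₁.root v ≡ false × 𝓡₂.root v ≡ false
  outside-root {v} e with 𝓡₁.root v | 𝓡₂.root v
  outside-root () | true  | _
  outside-root () | false | true
  outside-root _  | false | false = refl , refl

  rep-const : ∀ {u v} → u ∈ᵇ G → v ∈ᵇ G → root u ≡ false → root v ≡ false →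
              Touch u v → colour u ≡ colour v → rep u ≡ rep v
  rep-const {u} {v} gu gv ru rv uv e with G₁ u in g₁u | G₁ v in g₁v
  ... | true  | true  = 𝓡₁.rep-const g₁u g₁v (proj₁ (outside-root ru)) (proj₁ (outside-root rv)) uv e
  ... | false | false = 𝓡₂.rep-const (proj₂ (outside gu g₁u)) (proj₂ (outside gv g₁v))
                          (proj₂ (outside-root ru)) (proj₂ (outside-root rv)) uv e
  ... | true  | false = true≢false (S-root₁ gu (crossing g₁u gv g₁v uv)) (proj₁ (outside-root ru))
  ... | false | true  = true≢false (S-root₁ gv (crossing g₁v gu g₁u (touch-sym uv))) (proj₁ (outside-root rv))

-- W gets the colour κ and its neighbours the other one, so that W is a union
-- of components and the root of the rest is complete.
rooted-layer : ∀ {n r s D} {G W W′ : Vertex n → Bool} {κ} → spread s ≤ D →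
  (∀ {v} → v ∈ᵇ W → v ∈ᵇ G) → count W ≤ r →
  (∀ {u v} → u ∈ᵇ W → v ∈ᵇ G → Touch u v → v ∈ᵇ W′) →
  Rooted (λ v → G v ∧ not (W v)) W′ (not κ) s D →
  Rooted G W κ r D
rooted-layer {n} {r} {D = D} {G} {W} {κ = κ} le W⊆G size next 𝓡 = record
  { colour      = colour
  ; rep         = 𝓒.rep
  ; rep-near    = 𝓒.rep-near
  ; root        = W
  ; root⊆       = W⊆G
  ; ⊆root       = λ w _ → w
  ; root-colour = λ e → cong (λ w → if w then κ else _) e
  ; root-size   = size
  ; root-closed = root-closed
  ; rep-const   = λ {u} {v} gu gv wu wv uv e →
      𝓒.rep-const (∧-intro gu (cong not wu)) (∧-intro gv (cong not wv)) uv
        (trans (sym (colour-outside wu)) (trans e (colour-outside wv)))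
  }
  where
  module 𝓡 = Rooted 𝓡
  module 𝓒 = Coloured (proj₁ (coloured le 𝓡))
  colour : Vertex n → Bool
  colour v = if W v then κ else 𝓒.colour v

  colour-outside : ∀ {v} → W v ≡ false → colour v ≡ 𝓒.colour v
  colour-outside e rewrite e = refl

  root-closed : ∀ {u v} → u ∈ᵇ W → v ∈ᵇ G → Touch u v → colour v ≡ κ → v ∈ᵇ W
  root-closed {u} {v} w g uv e with decide (W v)
  ... | inj₁ w′ = w′
  -- A neighbour of `W` outside `W` is in the root of the rest and so has the other colour.
  ... | inj₂ ¬w = contradiction
    (trans (sym (𝓡.root-colour (𝓡.⊆root (next w g uv) (∧-intro g (cong not ¬w))))) (trans (sym (colour-outside ¬w)) e))
    (Bool.not-¬ refl ∘ sym)

module Sizes (t : ℕ) where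
  -- 4t, the most that a side of a separator and its bag can have together. A larger `W` is split,
  -- any other becomes a layer.
  step : ℕ
  step = t + (t + (t + t))

  -- Unfolding size layer would take exponential time.
  abstract
    size : ℕ → ℕ
    size zero    = suc step
    size (suc w) = size w + size w

    size-suc : ∀ w → size w + size w ≡ size (suc w)
    size-suc w = refl

    step<size : ∀ w → step < size w
    step<size zero    = ℕ.≤-refl
    step<size (suc w) = ℕ.≤-trans (step<size w) (ℕ.m≤m+n _ _)

    -- Bounds the neighbours of a layer, which has at most `step` vertices of `W` and one more.
    layer : ℕ
    layer = suc step * 27

    layer-size : suc step * 27 ≤ layer
    layer-size = ℕ.≤-refl

  abstract
    radius : ℕ
    radius = spread (size layer)

    spread≤radius : spread (size layer) ≤ radius
    spread≤radius = ℕ.≤-refl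

module Clustering {N t : ℕ} (A : Vertex (suc N) → Bool) (𝒟 : TreeDecomposition (induced (Q (suc N)) A))
  (small : ∀ i → length (TreeDecomposition.bag 𝒟 i) ≤ t)
  (adj? : ∀ i j → Dec (Graph.Adj (TreeDecomposition.tree 𝒟) i j)) where

  open Sizes t
  open Bags A 𝒟 using (Y; Y⊆A)
  open Separation A 𝒟 small adj?

  private
    V : Set
    V = Vertex (suc N)

  rooted-empty : ∀ {G W : V → Bool} {κ r} → (∀ {v} → v ∈ᵇ G → ⊥) → Rooted G W κ r radius
  rooted-empty {κ = κ} ∅ = record
    { colour      = λ _ → κ
    ; rep         = λ v → v
    ; rep-near    = λ v → near-refl
    ; root        = λ _ → false
    ; root⊆       = λ ()
    ; ⊆root       = λ _ g → ⊥-elim (∅ g)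
    ; root-colour = λ ()
    ; root-size   = ℕ.≤-trans (ℕ.≤-reflexive (count-empty (λ ()))) z≤n
    ; root-closed = λ ()
    ; rep-const   = λ g → ⊥-elim (∅ g)
    }

  -- Lexicographic induction on `g` and `w`. A large `W` is split at a balanced separator. A small
  -- one becomes a layer of colour `κ`, and its neighbours are the next `W`, with the opposite
  -- colour. Their number is at most `layer`, whatever `G` is, and each split doubles the bound on
  -- the root, hence `size`.
  cluster : ∀ g w (G W : V → Bool) κ → (∀ {v} → v ∈ᵇ G → v ∈ᵇ A) → (∀ {v} → v ∈ᵇ W → v ∈ᵇ A) →
            count G ≤ g → count W ≤ w → Rooted G W κ (size w) radius
  cluster g w G W κ G⊆A W⊆A G≤ W≤ = by-size g w G≤ W≤ (count W ℕ.≤? step)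
    where
    -- The vertex `x` of `G` makes the rest smaller even if `W` misses `G`.
    grown : V → V → Bool
    grown x v = G v ∧ (W v ∨ member (x ∷ []) v)

    grown-size : ∀ x → count W ≤ step → count (grown x) ≤ suc step
    grown-size x le = ℕ.≤-trans
      (count-cover {P = grown x} {W} {member (x ∷ [])} (λ e → ∨-inv (proj₂ (∧-inv e))))
      (ℕ.≤-trans (ℕ.+-mono-≤ le (count-member (x ∷ []))) (ℕ.≤-reflexive (ℕ.+-comm step 1)))

    rest : V → V → Bool
    rest x v = G v ∧ not (grown x v)

    next : V → V → Bool
    next x v = A v ∧ member (neighbours (elements (grown x))) v

    next-size : ∀ x → count W ≤ step → count (next x) ≤ layer
    next-size x le = ℕ.≤-trans (count-mono {P = next x} {member l} (λ e → proj₂ (∧-inv e)))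
      (ℕ.≤-trans (count-member l) (ℕ.≤-trans (ℕ.≤-reflexive (trans (length-neighbours (elements (grown x))) (cong (_* 27) (count-elements (grown x)))))
        (ℕ.≤-trans (ℕ.*-monoˡ-≤ 27 (grown-size x le)) layer-size)))
      where
      l : List V
      l = neighbours (elements (grown x))

    rest-size : ∀ x → x ∈ᵇ G → count (rest x) < count G
    rest-size x Gx = count-< {P = rest x} {G} {x} ∧-inl Gx
      (trans (cong (λ y → G x ∧ not y) (∧-intro Gx (∨-inr {W x} (member-intro (here refl))))) (Bool.∧-zeroʳ (G x)))

    weaken : ∀ {x r} → Rooted G (grown x) κ r radius → Rooted G W κ r radius
    weaken 𝓡 = record
      { Rooted 𝓡 ; ⊆root = λ w g → Rooted.⊆root 𝓡 (∧-intro g (∨-inl w)) g }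

    by-size : ∀ g w → count G ≤ g → count W ≤ w → Dec (count W ≤ step) → Rooted G W κ (size w) radius
    by-size g zero    G≤ W≤ (no big) = contradiction (ℕ.≤-trans W≤ z≤n) big
    by-size g (suc w) G≤ W≤ (no big) = subst (λ r → Rooted G W κ r radius) (size-suc w) (rooted-split {A = A} {side} {Y node} G⊆A closed
      (cluster g w _ _ κ (λ e → G⊆A (∧-inl e)) (λ e → [ (λ e → W⊆A (∧-inl e)) , Y⊆A ]′ (∨-inv e))
        (ℕ.≤-trans (count-mono ∧-inl) G≤) inner≤)
      (cluster g w _ _ κ (λ e → G⊆A (∧-inl e)) (λ e → [ (λ e → W⊆A (∧-inl e)) , Y⊆A ]′ (∨-inv e))
        (ℕ.≤-trans (count-mono ∧-inl) G≤) outer≤))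
      where
      open Separator (separate W W⊆A (ℕ.≤-<-trans (ℕ.+-monoʳ-≤ t (ℕ.m≤m+n t (t + t))) (ℕ.≰⇒> big)))
      inner outer : V → Bool
      inner v = W v ∧ side v
      outer v = W v ∧ not (side v)
      inner≤ : count (λ v → inner v ∨ Y node v) ≤ w
      inner≤ = ℕ.≤-pred (begin-strict
        count (λ v → inner v ∨ Y node v) ≤⟨ count-cover ∨-inv ⟩
        count inner + count (Y node)     ≤⟨ ℕ.+-mono-≤ small′ (bag-count node) ⟩
        (t + (t + t)) + t                ≡⟨ ℕ.+-comm (t + (t + t)) t ⟩
        step                             <⟨ ℕ.≰⇒> big ⟩
        count W                          ≤⟨ W≤ ⟩
        suc w                            ∎)
        where open ℕ.≤-Reasoning
      outer≤ : count (λ v → outer v ∨ Y node v) ≤ w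
      outer≤ = ℕ.≤-pred (begin-strict
        count (λ v → outer v ∨ Y node v) ≤⟨ count-cover ∨-inv ⟩
        count outer + count (Y node)     ≤⟨ ℕ.+-monoʳ-≤ (count outer) (bag-count node) ⟩
        count outer + t                  <⟨ ℕ.+-monoʳ-< (count outer) large ⟩
        count outer + count inner        ≤⟨ count-disjoint {P = W} {outer} {inner}
                                              (λ {v} e → ∧-inl e , trans (cong (W v ∧_) (not-true (proj₂ (∧-inv e)))) (Bool.∧-zeroʳ (W v))) ∧-inl ⟩
        count W                          ≤⟨ W≤ ⟩
        suc w                            ∎)
        where open ℕ.≤-Reasoning
    by-size zero    w G≤ W≤ (yes le) = rooted-empty λ g → contradiction (ℕ.≤-trans (count-pos {P = G} g) G≤) λ ()
    by-size (suc g) w G≤ W≤ (yes le) with any G (univ (suc N)) in e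
    ... | false = rooted-empty λ {v} Gv → true≢false (any-true {H = G} (∈-univ v) Gv) e
    ... | true  = let (x , _ , Gx) = any-inv {H = G} (univ (suc N)) e in
      weaken {x} (rooted-layer {W = grown x} {next x} spread≤radius ∧-inl (ℕ.≤-trans (grown-size x le) (step<size w))
        (λ {u} {v} w∈ v∈ uv → ∧-intro (G⊆A v∈) (member-intro (∈-neighbours (∈-elements {P = grown x} w∈) uv)))
        (cluster g layer (rest x) (next x) (not κ) (λ e → G⊆A (∧-inl e)) ∧-inl
          (ℕ.≤-pred (ℕ.≤-trans (rest-size x Gx) G≤)) (next-size x le)))

  clustering : Coloured A radius
  clustering = proj₁ (coloured spread≤radius
    (cluster (count A) layer A (λ _ → false) true (λ a → a) (λ ()) ℕ.≤-refl
      (ℕ.≤-trans (ℕ.≤-reflexive (count-empty (λ ()))) z≤n)))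

-- Search for clustered colourings

Searchable : Set → Set₁
Searchable C = ∀ {P : C → Set} → (∀ c → Dec (P c)) → Dec (∃ P)

search-Bool : Searchable Bool
search-Bool P? with P? true | P? false
... | yes p | _     = yes (true , p)
... | no _  | yes q = yes (false , q)
... | no ¬p | no ¬q = no λ { (true , p) → ¬p p ; (false , q) → ¬q q }

search-Fin : ∀ {n} → Searchable (Fin n)
search-Fin = Fin.any?

search-× : ∀ {C D} → Searchable C → Searchable D → Searchable (C × D)
search-× c d P? = map′ (λ (x , y , p) → (x , y) , p) (λ ((x , y) , p) → x , y , p) (c λ x → d λ y → P? (x , y))

search-Vec : ∀ {C} → Searchable C → ∀ n → Searchable (Vec C n)
search-Vec c zero    P? = map′ (λ p → [] , p) (λ { ([] , p) → p }) (P? [])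
search-Vec c (suc n) P? = map′ (λ (x , xs , p) → x ∷ xs , p) (λ { (x ∷ xs , p) → x , xs , p })
  (c λ x → search-Vec c n λ xs → P? (x ∷ xs))

module _ {n : ℕ} where

  all-vertices? : ∀ {P : Vertex n → Set} → (∀ v → Dec (P v)) → Dec (∀ v → P v)
  all-vertices? P? = map′ (λ ps v → All.lookup ps (∈-univ v)) (λ p → All.universal p (univ n)) (all? P? (univ n))

  near? : ∀ d (u v : Vertex n) → Dec (Near d u v)
  near? d u v = close? (xc u) (xc v) ×-dec (close? (yc u) (yc v) ×-dec close? (zc u) (zc v))
    where
    close? : ∀ m o → Dec (Close d m o)
    close? m o = (m ℕ.≤? d + o) ×-dec (o ℕ.≤? d + m)

  -- Tables instead of functions, since without extensionality only the
  -- former can be enumerated.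
  Table : Set
  Table = Vec (Vec (Vec (Bool × Vertex n) n) n) n

  search-Table : Searchable Table
  search-Table = search-Vec (search-Vec (search-Vec
    (search-× search-Bool (search-× search-Fin (search-× search-Fin search-Fin))) n) n) n

  entry : Table → Vertex n → Bool × Vertex n
  entry T (x , y , z) = Vec.lookup (Vec.lookup (Vec.lookup T x) y) z

  table : (Vertex n → Bool × Vertex n) → Table
  table f = Vec.tabulate λ x → Vec.tabulate λ y → Vec.tabulate λ z → f (x , y , z)

  entry-table : ∀ f v → entry (table f) v ≡ f v
  entry-table f (x , y , z)
    rewrite Vec.lookup∘tabulate (λ x → Vec.tabulate λ y → Vec.tabulate λ z → f (x , y , z)) x
          | Vec.lookup∘tabulate (λ y → Vec.tabulate λ z → f (x , y , z)) y
          = Vec.lookup∘tabulate (λ z → f (x , y , z)) z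

  coloured? : ∀ (G : Vertex n → Bool) D → Dec (Coloured G D)
  coloured? G D = map′ to from (search-Table λ T →
    all-vertices? (λ v → near? D v (rep T v)) ×-dec
    all-vertices? λ u → all-vertices? λ v →
      (G u Bool.≟ true) →-dec ((G v Bool.≟ true) →-dec (touch? u v →-dec
      ((colour T u Bool.≟ colour T v) →-dec (rep T u ≟ᵛ rep T v)))))
    where
    colour : Table → Vertex n → Bool
    colour T v = proj₁ (entry T v)
    rep : Table → Vertex n → Vertex n
    rep T v = proj₂ (entry T v)
    Valid : Table → Set
    Valid T = (∀ v → Near D v (rep T v)) ×
      (∀ u v → u ∈ᵇ G → v ∈ᵇ G → Touch u v → colour T u ≡ colour T v → rep T u ≡ rep T v)
    to : ∃ Valid → Coloured G D
    to (T , near , const) = record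
      { colour = colour T ; rep = rep T ; rep-near = near ; rep-const = const _ _ }
    from : Coloured G D → ∃ Valid
    from 𝓒 = table f , (λ v → subst (Near D v) (sym (cong proj₂ (entry-table f v))) (𝓒.rep-near v)) , const
      where
      module 𝓒 = Coloured 𝓒
      f : Vertex n → Bool × Vertex n
      f v = 𝓒.colour v , 𝓒.rep v
      const : ∀ u v → u ∈ᵇ G → v ∈ᵇ G → Touch u v →
              colour (table f) u ≡ colour (table f) v → rep (table f) u ≡ rep (table f) v
      const u v gu gv uv e rewrite entry-table f u | entry-table f v = 𝓒.rep-const gu gv uv e

-- Narrow decompositions and the choice of the wide part

module _ {V : Set} {G : Graph V} (𝒟 : TreeDecomposition G) where
  open TreeDecomposition 𝒟

  small-bags : ∀ {t} → ¬ (ℤ.+ t ℤ.≤ width) → ∀ i → length (bag i) ≤ t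
  small-bags {t} narrow i = ℕ.≮⇒≥ λ t< → narrow (wide (ℕ.≤-trans t< bag≤))
    where
    bag≤ : length (bag i) ≤ max 0 (List.tabulate (λ i → length (bag i)))
    bag≤ = tabulate⁻ (xs≤max 0 (List.tabulate (λ i → length (bag i)))) i
    wide : ∀ {m} → t < m → ℤ.+ t ℤ.≤ m ⊖ 1
    wide (s≤s t≤) = +≤+ t≤

theorem1 : (t : ℕ) → ∃ λ (n : ℕ) → n ≥ 1 ×
    ((A₁ A₂ : Vertex n → Bool) → IsPartition A₁ A₂ →
    TreewidthAtLeast (induced (Q n) A₁) t ⊎
    TreewidthAtLeast (induced (Q n) A₂) t)
theorem1 t = suc N , s≤s z≤n , λ A₁ A₂ part → choose A₁ A₂ part (coloured? A₁ D)
  where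
  D N : ℕ
  D = Sizes.radius t
  -- `D` more than the outermost plane, so that every plane that may be chosen is in `Range`.
  N = D + planes D t
  wide : ∀ {A : Vertex (suc N) → Bool} (𝒟 : TreeDecomposition (induced (Q (suc N)) A)) →
         ((∀ i → length (TreeDecomposition.bag 𝒟 i) ≤ t) → ⊥) → ℤ.+ t ℤ.≤ TreeDecomposition.width 𝒟
  -- The comparison is decidable, so it may be proved by contradiction; the goal `⊥` then allows
  -- adjacency in the tree to be decided.
  wide 𝒟 not-small = decidable-stable (ℤ.+ t ℤ.≤? TreeDecomposition.width 𝒟) λ narrow → not-small (small-bags 𝒟 narrow)
  choose : ∀ A₁ A₂ → IsPartition A₁ A₂ → Dec (Coloured A₁ D) →
           TreewidthAtLeast (induced (Q (suc N)) A₁) t ⊎ TreewidthAtLeast (induced (Q (suc N)) A₂) t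
  choose A₁ A₂ part (no uncoloured) = inj₁ λ 𝒟 → wide 𝒟 λ small →
    ¬¬-decidable (Graph.Adj (TreeDecomposition.tree 𝒟)) λ adj? →
      uncoloured (Clustering.clustering A₁ 𝒟 small adj?)
  choose A₁ A₂ part (yes 𝓒) = inj₂ λ 𝒟 → wide 𝒟 λ small →
    Contradiction.contradictory ℕ.≤-refl A₂ 𝓒.colour 𝓒.rep 𝓒.rep-near
      (λ u∉ v∉ → 𝓒.rep-const (in-A₁ u∉) (in-A₁ v∉)) 𝒟 small
    where
    module 𝓒 = Coloured 𝓒
    in-A₁ : ∀ {v} → A₂ v ≡ false → v ∈ᵇ A₁
    in-A₁ {v} v∉ with IsPartition.cover part v
    ... | inj₁ p = Equivalence.to Bool.T-≡ p
    ... | inj₂ p = true≢false (Equivalence.to Bool.T-≡ p) v∉
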